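{- Let $d_1,\dots,d_k$ be distinct positive integers and let $m$ be their least common multiple. Suppose $f(x)\in\mathbb{Q}[x]$ satisfies $\deg f(x)<\sum_{j=1}^{k}\phi(d_j)$ (where $\phi$ is Euler's totient function) and no root of $f$ is an $m$-th root of unity. Then $$f(x)\prod_{j=1}^{k}\frac{1}{\Phi_{d_j}(x)}=\sum_{j=1}^{k}\frac{\big(-f(x)\,g(x)\,x\,\Phi_{d_j}'(x)\big)\ \mathrm{rem}\ \Phi_{d_j}(x)}{m\,\Phi_{d_j}(x)},$$ where $g(x)=(1-x^m)\big/\prod_{j=1}^{k}\Phi_{d_j}(x)$.
   Context: $\Phi_n(x)$ is the $n$-th cyclotomic polynomial, with the convention $\Phi_1(x)=1-x$ (so that $1-x^m=\prod_{d\mid m}\Phi_d(x)$); for $n\ge2$ it is the usual (monic) cyclotomic polynomial. $\Phi_n'$ is its derivative. For $f,p\in\mathbb{Q}[x]$ with $p\neq0$, $f\ \mathrm{rem}\ p$ denotes the remainder of $f$ on Euclidean division by $p$ (the unique polynomial of degree $<\deg p$ congruent to $f$ modulo $p$). -}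

module Defs where

open import Data.Bool using (if_then_else_)
open import Data.List using (List; []; _∷_; map; length; filter; upTo)
open import Data.List.Relation.Unary.All as All using (All; []; _∷_)
open import Data.Nat as ℕ using (ℕ; zero; suc)
open import Data.Nat.Coprimality using (coprime?)
open import Data.Nat.Divisibility using (_∣?_)
open import Data.Nat.LCM using (lcm)
open import Data.Product using (∃-syntax; _×_; _,_)
open import Data.Rational
  using (ℚ; 0ℚ; 1ℚ; _+_; _*_; _-_; -_; 1/_; _<_; ≢-nonZero)
open import Data.Rational.Properties
  using (_≟_; +-identityˡ; +-identityʳ; *-zeroˡ; *-zeroʳ; *-identityˡ; *-assoc; *-inverseˡ)
open import Data.Sum using (_⊎_; inj₁; inj₂)
open import Data.Vec.Functional using (Vector; foldr)
open import Relation.Binary.PropositionalEquality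
  using (_≡_; _≢_; refl; sym; trans; cong)
open import Relation.Nullary using (¬_; Dec; yes; no; ⌊_⌋)
open import Relation.Nullary.Decidable using (map′)

φ : ℕ → ℕ
φ n = length (filter (λ a → coprime? (suc a) n) (upTo n))

sum : ∀ {k} → Vector ℕ k → ℕ
sum = foldr ℕ._+_ 0

lcms : ∀ {k} → Vector ℕ k → ℕ
lcms = foldr lcm 1

-- a₀ ∷ a₁ ∷ … ∷ [] stands for a₀ + a₁x + …; trailing zeros are allowed,
-- so equality of polynomials is _≈_ rather than _≡_.
Poly : Set
Poly = List ℚ

coeff : Poly → ℕ → ℚ
coeff []      _       = 0ℚ
coeff (a ∷ p) zero    = a
coeff (a ∷ p) (suc n) = coeff p n

infix 4 _≈_ _≉_

record _≈_ (p q : Poly) : Set where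
  constructor mk≈
  field coeff-≡ : ∀ n → coeff p n ≡ coeff q n

open _≈_ public

_≉_ : Poly → Poly → Set
p ≉ q = ¬ (p ≈ q)

0ᵖ 1ᵖ X : Poly
0ᵖ = []
1ᵖ = 1ℚ ∷ []
X  = 0ℚ ∷ 1ℚ ∷ []

infixl 6 _+ᵖ_ _-ᵖ_
infixl 7 _*ᵖ_ _·ᵖ_
infix  8 -ᵖ_

_+ᵖ_ : Poly → Poly → Poly
[]      +ᵖ q       = q
(a ∷ p) +ᵖ []      = a ∷ p
(a ∷ p) +ᵖ (b ∷ q) = a + b ∷ p +ᵖ q

-ᵖ_ : Poly → Poly
-ᵖ_ = map (-_)

_-ᵖ_ : Poly → Poly → Poly
p -ᵖ q = p +ᵖ -ᵖ q

_·ᵖ_ : ℚ → Poly → Poly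
c ·ᵖ p = map (c *_) p

_*ᵖ_ : Poly → Poly → Poly
[]      *ᵖ q = []
(a ∷ p) *ᵖ q = a ·ᵖ q +ᵖ (0ℚ ∷ p *ᵖ q)

∏ᵖ : ∀ {k} → Vector Poly k → Poly
∏ᵖ = foldr _*ᵖ_ 1ᵖ

X^_ : ℕ → Poly
X^ zero  = 1ᵖ
X^ suc n = 0ℚ ∷ X^ n

-- (a + x p)′ = p + x p′
derivative : Poly → Poly
derivative []      = []
derivative (a ∷ p) = p +ᵖ (0ℚ ∷ derivative p)

_≈0? : (p : Poly) → Dec (p ≈ 0ᵖ)
p ≈0? = map′ to (λ e → from p (coeff-≡ e)) (All.all? (_≟ 0ℚ) p)
  where
  to : ∀ {p} → All (_≡ 0ℚ) p → p ≈ 0ᵖ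
  to {p} z = mk≈ (go z)
    where
    go : ∀ {p} → All (_≡ 0ℚ) p → ∀ n → coeff p n ≡ 0ℚ
    go []      n       = refl
    go (e ∷ z) zero    = e
    go (e ∷ z) (suc n) = go z n
  from : ∀ p → (∀ n → coeff p n ≡ 0ℚ) → All (_≡ 0ℚ) p
  from []      e = []
  from (a ∷ p) e = e 0 ∷ from p (λ n → e (suc n))

-- deg 0 = 0 by convention.
deg : Poly → ℕ
deg []      = 0
deg (a ∷ p) = if ⌊ p ≈0? ⌋ then 0 else suc (deg p)

leading : Poly → ℚ
leading p = coeff p (deg p)

-- Extended by recip 0 = 0.
recip : ℚ → ℚ
recip c with c ≟ 0ℚ
... | yes _   = 0ℚ
... | no c≢0 = (1/ c) {{≢-nonZero c≢0}}

-- Euclidean division by p ≉ 0ᵖ, one coefficient of the dividend at a time: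
-- if f = q p + r then a + x f = (x q) p + (a + x r), where a + x r has degree
-- at most deg p, and its coefficient at deg p is cleared by subtracting a
-- multiple t p of p.  For p ≈ 0ᵖ these are the junk values f quot p ≈ 0ᵖ
-- and f rem p ≈ f.
infixl 7 _quot_ _rem_

_rem_ : Poly → Poly → Poly
[]      rem p = []
(a ∷ f) rem p = s -ᵖ t ·ᵖ p
  where
  s = a ∷ f rem p
  t = coeff s (deg p) * recip (leading p)

_quot_ : Poly → Poly → Poly
[]      quot p = []
(a ∷ f) quot p = coeff (a ∷ f rem p) (deg p) * recip (leading p) ∷ f quot p

-- The recursion Φ n = (1 - xⁿ) / ∏ { Φ e ∣ e divides n, e < n } gives Φ 1 = 1 - x
-- and, for n ≥ 2, the usual monic cyclotomic polynomial: there the divisor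
-- contains the factor 1 - x exactly once, which absorbs the sign.
-- Φ 0 is a junk value.
mutual
  Φ : ℕ → Poly
  Φ zero    = 1ᵖ
  Φ (suc n) = (1ᵖ -ᵖ X^ suc n) quot ∏Φ∣ (suc n) n

  -- ∏Φ∣ n b is the product of Φ e over the divisors e of n with 1 ≤ e ≤ b.
  ∏Φ∣ : ℕ → ℕ → Poly
  ∏Φ∣ n zero    = 1ᵖ
  ∏Φ∣ n (suc b) = if ⌊ suc b ∣? n ⌋ then Φ (suc b) *ᵖ ∏Φ∣ n b else ∏Φ∣ n b

record ℚ[i] : Set where
  constructor _+i_
  field re im : ℚ

open ℚ[i]

infixl 6 _+ᵍ_ _-ᵍ_
infixl 7 _*ᵍ_
infixr 8 _^ᵍ_

_+ᵍ_ _-ᵍ_ _*ᵍ_ : ℚ[i] → ℚ[i] → ℚ[i]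
(a +i b) +ᵍ (c +i d) = (a + c) +i (b + d)
(a +i b) -ᵍ (c +i d) = (a - c) +i (b - d)
(a +i b) *ᵍ (c +i d) = (a * c - b * d) +i (a * d + b * c)

fromℚ : ℚ → ℚ[i]
fromℚ a = a +i 0ℚ

_^ᵍ_ : ℚ[i] → ℕ → ℚ[i]
z ^ᵍ zero  = fromℚ 1ℚ
z ^ᵍ suc n = z *ᵍ z ^ᵍ n

∣_∣² : ℚ[i] → ℚ
∣ z ∣² = re z * re z + im z * im z

evalᵍ : Poly → ℚ[i] → ℚ[i]
evalᵍ []      z = fromℚ 0ℚ
evalᵍ (a ∷ p) z = fromℚ a +ᵍ z *ᵍ evalᵍ p z

-- ℂ as the metric completion of ℚ(i).
record ℂ : Set where
  field
    seq    : ℕ → ℚ[i]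
    cauchy : ∀ ε → 0ℚ < ε → ∃[ N ] (∀ m n → N ℕ.≤ m → N ℕ.≤ n →
               ∣ seq m -ᵍ seq n ∣² < ε * ε)

open ℂ

infix 4 _⟶_

_⟶_ : (ℕ → ℚ[i]) → ℚ[i] → Set
s ⟶ l = ∀ ε → 0ℚ < ε → ∃[ N ] (∀ n → N ℕ.≤ n → ∣ s n -ᵍ l ∣² < ε * ε)

-- Ring operations on ℂ are pointwise on representing sequences, so p(z) = 0 and
-- zᵐ = 1 say that the sequences p(zₙ) and zₙᵐ converge to 0 and to 1.
IsRoot : Poly → ℂ → Set
IsRoot p z = (λ n → evalᵍ p (seq z n)) ⟶ fromℚ 0ℚ

IsRootOfUnity : ℕ → ℂ → Set
IsRootOfUnity m z = (λ n → seq z n ^ᵍ m) ⟶ fromℚ 1ℚ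

coeff-+ᵖ : ∀ p q n → coeff (p +ᵖ q) n ≡ coeff p n + coeff q n
coeff-+ᵖ []      q       n       = sym (+-identityˡ _)
coeff-+ᵖ (a ∷ p) []      n       = sym (+-identityʳ _)
coeff-+ᵖ (a ∷ p) (b ∷ q) zero    = refl
coeff-+ᵖ (a ∷ p) (b ∷ q) (suc n) = coeff-+ᵖ p q n

coeff-·ᵖ : ∀ c p n → coeff (c ·ᵖ p) n ≡ c * coeff p n
coeff-·ᵖ c []      n       = sym (*-zeroʳ c)
coeff-·ᵖ c (a ∷ p) zero    = refl
coeff-·ᵖ c (a ∷ p) (suc n) = coeff-·ᵖ c p n

coeff-∷*ᵖ : ∀ a p q n →
  coeff ((a ∷ p) *ᵖ q) n ≡ a * coeff q n + coeff (0ℚ ∷ p *ᵖ q) n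
coeff-∷*ᵖ a p q n =
  trans (coeff-+ᵖ (a ·ᵖ q) _ n) (cong (_+ coeff (0ℚ ∷ p *ᵖ q) n) (coeff-·ᵖ a q n))

coeff-*ᵖ0∷ : ∀ p b q → b ≡ 0ℚ → ∀ n →
  coeff (p *ᵖ (b ∷ q)) n ≡ coeff (0ℚ ∷ p *ᵖ q) n
coeff-*ᵖ0∷ []      b q refl zero    = refl
coeff-*ᵖ0∷ []      b q refl (suc n) = refl
coeff-*ᵖ0∷ (a ∷ p) b q refl zero    =
  trans (coeff-∷*ᵖ a p (0ℚ ∷ q) 0) (trans (+-identityʳ _) (*-zeroʳ a))
coeff-*ᵖ0∷ (a ∷ p) b q refl (suc n) =
  trans (coeff-∷*ᵖ a p (0ℚ ∷ q) (suc n))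
    (trans (cong (_+_ (a * coeff q n)) (coeff-*ᵖ0∷ p b q refl n))
      (sym (coeff-∷*ᵖ a p q n)))

*-cancel-0 : ∀ {a b} → a ≢ 0ℚ → a * b ≡ 0ℚ → b ≡ 0ℚ
*-cancel-0 {a} {b} a≢0 ab≡0 =
  trans (sym (*-identityˡ b))
    (trans (cong (_* b) (sym (*-inverseˡ a)))
      (trans (*-assoc (1/ a) a b) (trans (cong ((1/ a) *_) ab≡0) (*-zeroʳ (1/ a)))))
  where instance _ = ≢-nonZero a≢0

*ᵖ-zero-divisor-free : ∀ p q → p *ᵖ q ≈ 0ᵖ → p ≈ 0ᵖ ⊎ q ≈ 0ᵖ
*ᵖ-zero-divisor-free [] q e = inj₁ (mk≈ λ _ → refl)
*ᵖ-zero-divisor-free (a ∷ p) q e with a ≟ 0ℚ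
... | no a≢0 = inj₂ (mk≈ (go q (coeff-≡ e)))
  where
  go : ∀ q → (∀ n → coeff ((a ∷ p) *ᵖ q) n ≡ 0ℚ) → ∀ n → coeff q n ≡ 0ℚ
  go []      e n = refl
  go (b ∷ q) e = λ { zero → b≡0 ; (suc n) → go q e′ n }
    where
    b≡0 : b ≡ 0ℚ
    b≡0 = *-cancel-0 a≢0
      (trans (sym (+-identityʳ _)) (trans (sym (coeff-∷*ᵖ a p (b ∷ q) 0)) (e 0)))
    e′ : ∀ n → coeff ((a ∷ p) *ᵖ q) n ≡ 0ℚ
    e′ n = trans (sym (coeff-*ᵖ0∷ (a ∷ p) b q b≡0 (suc n))) (e (suc n))
... | yes a≡0 with *ᵖ-zero-divisor-free p q (mk≈ λ n →
        trans (sym (trans (cong (λ c → c * coeff q (suc n) + coeff (p *ᵖ q) n) a≡0)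
                   (trans (cong (_+ coeff (p *ᵖ q) n) (*-zeroˡ (coeff q (suc n)))) (+-identityˡ _))))
          (trans (sym (coeff-∷*ᵖ a p q (suc n))) (coeff-≡ e (suc n))))
...   | inj₁ p≈0 = inj₁ (mk≈ λ { zero → a≡0 ; (suc n) → coeff-≡ p≈0 n })
...   | inj₂ q≈0 = inj₂ q≈0

*ᵖ-≉0 : ∀ {p q} → p ≉ 0ᵖ → q ≉ 0ᵖ → p *ᵖ q ≉ 0ᵖ
*ᵖ-≉0 {p} {q} p≉0 q≉0 e with *ᵖ-zero-divisor-free p q e
... | inj₁ p≈0 = p≉0 p≈0
... | inj₂ q≈0 = q≉0 q≈0

1ᵖ≉0 : 1ᵖ ≉ 0ᵖ
1ᵖ≉0 e with coeff-≡ e 0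
... | ()

record ℚ⟨x⟩ : Set where
  constructor mkFrac
  field
    num    : Poly
    den    : Poly
    .den≉0 : den ≉ 0ᵖ

open ℚ⟨x⟩ public

infix 4 _≃_

record _≃_ (u v : ℚ⟨x⟩) : Set where
  constructor mk≃
  field cross-≈ : num u *ᵖ den v ≈ num v *ᵖ den u

open _≃_ public

infixl 6 _+ᶠ_
infixl 7 _*ᶠ_ _/ᶠ_

_+ᶠ_ _*ᶠ_ : ℚ⟨x⟩ → ℚ⟨x⟩ → ℚ⟨x⟩
mkFrac a b b≉0 +ᶠ mkFrac c d d≉0 =
  mkFrac (a *ᵖ d +ᵖ c *ᵖ b) (b *ᵖ d) (*ᵖ-≉0 {b} {d} b≉0 d≉0)
mkFrac a b b≉0 *ᶠ mkFrac c d d≉0 =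
  mkFrac (a *ᵖ c) (b *ᵖ d) (*ᵖ-≉0 {b} {d} b≉0 d≉0)

fromPoly : Poly → ℚ⟨x⟩
fromPoly p = mkFrac p 1ᵖ 1ᵖ≉0

-- The quotient of two polynomials, extended by p /ᶠ 0 = 0.
_/ᶠ_ : Poly → Poly → ℚ⟨x⟩
p /ᶠ q with q ≈0?
... | yes _  = fromPoly 0ᵖ
... | no q≉0 = mkFrac p q q≉0

Σᶠ ∏ᶠ : ∀ {k} → Vector ℚ⟨x⟩ k → ℚ⟨x⟩
Σᶠ = foldr _+ᶠ_ (fromPoly 0ᵖ)
∏ᶠ = foldr _*ᶠ_ (fromPoly 1ᵖ)

{-# OPTIONS --safe #-}

-- Since 1 - Xᵇ is squarefree and 1 - X^gcd(a,b) lies in the ideal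
-- (1 - Xᵃ, 1 - Xᵇ), the Φ n with n ≥ 1 are pairwise comaximal.  Hence the
-- divisions defining Φ and g are exact, and Σ_{e ∣ n} φ(e) = n gives
-- deg Φ n = φ(n).  Put θ = X d/dX.  From θ(1 - Xᵐ) = m (1 - Xᵐ) - m it follows that
-- m f is congruent to Σⱼ rⱼ ∏_{i≠j} Φ dᵢ modulo every Φ dⱼ, where rⱼ is the
-- remainder in the theorem.  Both sides have degree less than deg ∏ⱼ Φ dⱼ,
-- so they are equal.
module Submission where

-- `Φ` is known only as a recursion of quotients, so neither roots nor irreducibility are at hand.
-- Comaximality replaces both: a Bézout identity is an explicit certificate that passes to products
-- and to divisors, and it lets the product of pairwise comaximal divisors of z divide z. There is a
-- circle to break. Exactness of the division defining `Φ n` needs comaximality of the earlier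
-- `Φ e`, while comaximality of `Φ a` and `Φ b` needs exactness at a, at b and at gcd(a, b). Since
-- only indices below n occur, one strong induction on exactness settles both. Squarefreeness comes
-- from the derivation θ: if u v = 1 - Xⁿ, then n = n u v - θ(u) v - u θ(v) lies in the ideal (u,
-- v), and n is invertible in ℚ. The same identity, with n = m and u = Φ dⱼ, is the origin of the
-- factor m in the denominators of the theorem.

open import Algebra.Bundles using (CommutativeRing)

-- Bézout identities, divisibility and partial-fraction numerators in a commutative ring.

module Comaximality {a ℓ} (R : CommutativeRing a ℓ) where
  open import Data.Fin using (zero; suc)
  open import Data.Nat as ℕ using (ℕ; zero; suc)
  import Data.Nat.Properties as ℕ
  open import Data.Nat.GCD using (gcd; gcd-GCD; module Bézout)
  import Data.Nat.Divisibility as ℕ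
  open import Data.Product using (∃₂; _,_)
  open import Data.Vec.Functional using (Vector; tail; removeAt)
  open import Function using (_∘_)
  open import Relation.Binary.PropositionalEquality as ≡ using (_≡_; _≢_)
  open CommutativeRing R hiding (zero)
  open import Algebra.Properties.CommutativeSemigroup.Divisibility *-commutativeSemigroup public
    using (_∣_; ∣ʳ-trans; ∣ʳ-respʳ-≈; x∣ʳy⇒x∣ʳzy; _,_)
  open import Algebra.Properties.Semiring.Exp semiring
    using (_^_; ^-homo-*; ^-assocʳ)
  open import Algebra.Properties.Ring ring
    using (⁻¹-anti-homo‿-; -‿involutive; //-rightDividesˡ; //-rightDividesʳ; -‿distribˡ-*;
      x[y-z]≈xy-xz; [y-z]x≈yx-zx)
  open import Algebra.Properties.CommutativeMonoid.Sum *-commutativeMonoid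
    using () renaming (sum to ∏; sum-remove to ∏-remove; sum-cong-≋ to ∏-cong)
  open import Algebra.Properties.CommutativeSemigroup *-commutativeSemigroup
    using () renaming (interchange to *-interchange)
  open import Algebra.Solver.Ring.NaturalCoefficients.Default commutativeSemiring
    using (solve; _:=_; _:+_; _:*_; con)
  open import Relation.Binary.Reasoning.Setoid setoid

  Comaximal : Carrier → Carrier → Set _
  Comaximal x y = ∃₂ λ s t → s * x + t * y ≈ 1#

  comaximal-sym : ∀ {x y} → Comaximal x y → Comaximal y x
  comaximal-sym (s , t , e) = t , s , trans (+-comm _ _) e

  comaximal-≈ : ∀ {x y z} → y ≈ z → Comaximal x y → Comaximal x z
  comaximal-≈ y≈z (s , t , e) = s , t , trans (+-congˡ (*-congˡ (sym y≈z))) e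

  comaximal-1 : ∀ {x} → Comaximal x 1#
  comaximal-1 {x} = 0# , 1# , trans (+-cong (zeroˡ x) (*-identityˡ 1#)) (+-identityˡ 1#)

  -- Multiply the two Bézout identities: every term of the product except t t′ y z contains x.
  comaximal-* : ∀ {x y z} → Comaximal x y → Comaximal x z → Comaximal x (y * z)
  comaximal-* {x} {y} {z} (s , t , e) (s′ , t′ , e′) =
    s * s′ * x + s * t′ * z + t * s′ * y , t * t′ , (begin
      (s * s′ * x + s * t′ * z + t * s′ * y) * x + t * t′ * (y * z)
        ≈⟨ solve 7 (λ s t s′ t′ x y z →
             (s :* s′ :* x :+ s :* t′ :* z :+ t :* s′ :* y) :* x :+ t :* t′ :* (y :* z)
               := (s :* x :+ t :* y) :* (s′ :* x :+ t′ :* z)) refl s t s′ t′ x y z ⟩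
      (s * x + t * y) * (s′ * x + t′ * z)  ≈⟨ *-cong e e′ ⟩
      1# * 1#                              ≈⟨ *-identityˡ 1# ⟩
      1#                                   ∎)

  comaximal-∣ : ∀ {x y z} → y ∣ z → Comaximal x z → Comaximal x y
  comaximal-∣ {x} {y} {z} (q , qy≈z) (s , t , e) = s , t * q , (begin
    s * x + t * q * y    ≈⟨ +-congˡ (*-assoc t q y) ⟩
    s * x + t * (q * y)  ≈⟨ +-congˡ (*-congˡ qy≈z) ⟩
    s * x + t * z        ≈⟨ e ⟩
    1#                   ∎)

  -- Both p and q lie in the ideal (x, y), hence so does α p + β q, and with it 1. Applied to x = Φ
  -- a, y = Φ b, p = 1 - Xᵃ, q = 1 - Xᵇ, where the combination is 1 - X^gcd(a,b).
  comaximal-∣-combination : ∀ {x y p q} α β → x ∣ p → y ∣ q →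
    Comaximal y (α * p + β * q) → Comaximal x y
  comaximal-∣-combination {x} {y} {p} {q} α β (u , ux≈p) (v , vy≈q) (s , t , e) =
    t * α * u , s + t * β * v , (begin
      t * α * u * x + (s + t * β * v) * y
        ≈⟨ solve 8 (λ t α u x s β v y →
             t :* α :* u :* x :+ (s :+ t :* β :* v) :* y
               := s :* y :+ t :* (α :* (u :* x) :+ β :* (v :* y))) refl t α u x s β v y ⟩
      s * y + t * (α * (u * x) + β * (v * y))
        ≈⟨ +-congˡ (*-congˡ (+-cong (*-congˡ ux≈p) (*-congˡ vy≈q))) ⟩
      s * y + t * (α * p + β * q)
        ≈⟨ e ⟩
      1# ∎)

  -- Multiply s x + t y = 1 by z, and write z as a multiple of y in the first term and of x in the
  -- second: each term then contains x y.
  comaximal-*-∣ : ∀ {x y z} → Comaximal x y → x ∣ z → y ∣ z → x * y ∣ z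
  comaximal-*-∣ {x} {y} {z} (s , t , e) (u , ux≈z) (v , vy≈z) =
    s * v + t * u , (begin
      (s * v + t * u) * (x * y)
        ≈⟨ solve 6 (λ s v t u x y →
             (s :* v :+ t :* u) :* (x :* y) := s :* x :* (v :* y) :+ t :* y :* (u :* x))
             refl s v t u x y ⟩
      s * x * (v * y) + t * y * (u * x)
        ≈⟨ +-cong (*-congˡ vy≈z) (*-congˡ ux≈z) ⟩
      s * x * z + t * y * z
        ≈⟨ distribʳ z _ _ ⟨
      (s * x + t * y) * z
        ≈⟨ *-congʳ e ⟩
      1# * z
        ≈⟨ *-identityˡ z ⟩
      z ∎)

  comaximal-∏ : ∀ {n x} (v : Vector Carrier n) →
    (∀ i → Comaximal x (v i)) → Comaximal x (∏ v)
  comaximal-∏ {zero}  v c = comaximal-1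
  comaximal-∏ {suc n} v c = comaximal-* (c zero) (comaximal-∏ (tail v) (c ∘ suc))

  ∏-∣ : ∀ {n z} (v : Vector Carrier n) →
    (∀ {i j} → i ≢ j → Comaximal (v i) (v j)) → (∀ i → v i ∣ z) → ∏ v ∣ z
  ∏-∣ {zero}  {z} v c v∣z = z , *-identityʳ z
  ∏-∣ {suc n} v c v∣z =
    comaximal-*-∣ (comaximal-∏ (tail v) (λ i → c λ ())) (v∣z zero)
      (∏-∣ (tail v) (λ i≢j → c (λ { ≡.refl → i≢j ≡.refl })) (v∣z ∘ suc))

  ∣-minus : ∀ {x y z} → x ∣ y → x ∣ z → x ∣ y - z
  ∣-minus {x} {y} {z} (p , px≈y) (q , qx≈z) = p - q , (begin
    (p - q) * x    ≈⟨ [y-z]x≈yx-zx x p q ⟩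
    p * x - q * x  ≈⟨ +-cong px≈y (-‿cong qx≈z) ⟩
    y - z          ∎)

  ∣-minus-sym : ∀ {x y z} → x ∣ y - z → x ∣ z - y
  ∣-minus-sym {x} {y} {z} (q , e) = - q ,
    trans (sym (-‿distribˡ-* q x)) (trans (-‿cong e) (⁻¹-anti-homo‿- y z))

  ∣-minus-common : ∀ {w x y z} → w ∣ x - z → w ∣ y - z → w ∣ x - y
  ∣-minus-common {w} {x} {y} {z} p q = ∣ʳ-respʳ-≈ (begin
    x - z - (y - z)      ≈⟨ +-congˡ (⁻¹-anti-homo‿- y z) ⟩
    x - z + (z - y)      ≈⟨ +-assoc (x - z) z (- y) ⟨
    x - z + z - y        ≈⟨ +-congʳ (//-rightDividesˡ z x) ⟩
    x - y                ∎) (∣-minus p q)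

  1-xy≈[1-x]+x[1-y] : ∀ x y → 1# - x * y ≈ (1# - x) + x * (1# - y)
  1-xy≈[1-x]+x[1-y] x y = sym (begin
    (1# - x) + x * (1# - y)    ≈⟨ +-congˡ (trans (x[y-z]≈xy-xz x 1# y) (+-congʳ (*-identityʳ x))) ⟩
    (1# - x) + (x - x * y)     ≈⟨ +-assoc (1# - x) x (- (x * y)) ⟨
    (1# - x) + x - x * y       ≈⟨ +-congʳ (//-rightDividesˡ x 1#) ⟩
    1# - x * y                 ∎)

  -- The cofactor is the geometric sum 1 + x + ... + xⁿ⁻¹ in Horner form, empty for n = 0.
  1-x∣1-x^ : ∀ x n → 1# - x ∣ 1# - x ^ n
  1-x∣1-x^ x zero    = 0# , trans (zeroˡ _) (sym (-‿inverseʳ 1#))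
  1-x∣1-x^ x (suc n) with q , e ← 1-x∣1-x^ x n = 1# + x * q , (begin
    (1# + x * q) * (1# - x)          ≈⟨ solve 3 (λ x q y →
                                            (con 1 :+ x :* q) :* y := y :+ x :* (q :* y))
                                            refl x q (1# - x) ⟩
    (1# - x) + x * (q * (1# - x))    ≈⟨ +-congˡ (*-congˡ e) ⟩
    (1# - x) + x * (1# - x ^ n)      ≈⟨ 1-xy≈[1-x]+x[1-y] x (x ^ n) ⟨
    1# - x * x ^ n                   ∎)

  1-x^-∣ : ∀ x {m n} → m ℕ.∣ n → 1# - x ^ m ∣ 1# - x ^ n
  1-x^-∣ x {m} (ℕ.divides-refl k) =
    ∣ʳ-respʳ-≈ (+-congˡ (-‿cong (trans (^-assocʳ x m k) (reflexive (≡.cong (x ^_) (ℕ.*-comm m k))))))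
      (1-x∣1-x^ (x ^ m) k)

  -- If g + b y = a x then 1 - Xᵃˣ = (1 - Xᵍ) + Xᵍ (1 - Xᵇʸ), and the
  -- outer terms are multiples of 1 - Xᵃ and 1 - Xᵇ.
  1-x^gcd : ∀ x a b → ∃₂ λ α β → α * (1# - x ^ a) + β * (1# - x ^ b) ≈ 1# - x ^ gcd a b
  1-x^gcd x a b = go (Bézout.identity (gcd-GCD a b))
    where
    step : ∀ {a b} g s t → g ℕ.+ t ℕ.* b ≡ s ℕ.* a →
      ∃₂ λ α β → α * (1# - x ^ a) + β * (1# - x ^ b) ≈ 1# - x ^ g
    step {a} {b} g s t e
      with u , eu ← 1-x^-∣ x (ℕ.divides s ≡.refl) | v , ev ← 1-x^-∣ x {b} (ℕ.divides t ≡.refl)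
      = u , - (x ^ g * v) , (begin
        u * (1# - x ^ a) + - (x ^ g * v) * (1# - x ^ b)
          ≈⟨ +-cong (trans eu (+-congˡ (-‿cong (trans (reflexive (≡.cong (x ^_) (≡.sym e)))
               (^-homo-* x g (t ℕ.* b)))))) (lem (x ^ g) v (1# - x ^ b)) ⟩
        1# - x ^ g * x ^ (t ℕ.* b) - x ^ g * (v * (1# - x ^ b))
          ≈⟨ +-cong (1-xy≈[1-x]+x[1-y] (x ^ g) _) (-‿cong (*-congˡ ev)) ⟩
        (1# - x ^ g) + x ^ g * (1# - x ^ (t ℕ.* b)) - x ^ g * (1# - x ^ (t ℕ.* b))
          ≈⟨ //-rightDividesʳ _ _ ⟩
        1# - x ^ g ∎)
      where
      lem : ∀ p q r → - (p * q) * r ≈ - (p * (q * r))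
      lem p q r = trans (sym (-‿distribˡ-* (p * q) r)) (-‿cong (*-assoc p q r))

    go : ∀ {g} → Bézout.Identity g a b →
      ∃₂ λ α β → α * (1# - x ^ a) + β * (1# - x ^ b) ≈ 1# - x ^ g
    go {g} (Bézout.+- s t e) = step g s t e
    go {g} (Bézout.-+ s t e) with β , α , e′ ← step g t s e = α , β , trans (+-comm _ _) e′

  -- For w = 1 - Xᵐ and θ = X d/dX the last two hypotheses hold with n = m.
  factor-derivative : ∀ {u v w u′ v′ w′ n} → u * v ≈ w → w′ ≈ u′ * v + u * v′ →
    n + w′ ≈ n * w → (n * v - v′) * u ≈ n + u′ * v
  factor-derivative {u} {v} {w} {u′} {v′} {w′} {n} uv≈w dw e = begin
    (n * v - v′) * u                 ≈⟨ [y-z]x≈yx-zx u (n * v) v′ ⟩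
    n * v * u - v′ * u               ≈⟨ +-cong (*-assoc n v u) (-‿cong (*-comm v′ u)) ⟩
    n * (v * u) - u * v′             ≈⟨ +-congʳ (*-congˡ (trans (*-comm v u) uv≈w)) ⟩
    n * w - u * v′                   ≈⟨ +-congʳ e ⟨
    n + w′ - u * v′                  ≈⟨ +-congʳ (+-congˡ dw) ⟩
    n + (u′ * v + u * v′) - u * v′   ≈⟨ +-congʳ (+-assoc n (u′ * v) (u * v′)) ⟨
    n + u′ * v + u * v′ - u * v′     ≈⟨ //-rightDividesʳ (u * v′) (n + u′ * v) ⟩
    n + u′ * v                       ∎

  -- Modulo p, the first hypothesis times f says c f ≡ -(f g x p′) P, and the second replaces -(f g
  -- x p′) by r. In use p is one of the Φ dⱼ, P the product of the others, c the constant m and r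
  -- the remainder.
  ∣-residue : ∀ {p p′ x g P f c r} → p ∣ c + x * p′ * (g * P) →
    p ∣ - (f * g * x * p′) - r → p ∣ c * f - r * P
  ∣-residue {p} {p′} {x} {g} {P} {f} {c} {r} p∣c+ p∣h-r = ∣-minus-common
    (∣ʳ-respʳ-≈ (begin
      f * (c + x * p′ * (g * P))
        ≈⟨ solve 6 (λ f c x p g P → f :* (c :+ x :* p :* (g :* P)) := c :* f :+ f :* g :* x :* p :* P)
             refl f c x p′ g P ⟩
      c * f + f * g * x * p′ * P
        ≈⟨ +-congˡ (-‿involutive _) ⟨
      c * f - - (f * g * x * p′ * P)
        ≈⟨ +-congˡ (-‿cong (-‿distribˡ-* (f * g * x * p′) P)) ⟩
      c * f - - (f * g * x * p′) * P ∎)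
      (x∣ʳy⇒x∣ʳzy f p∣c+))
    (∣ʳ-respʳ-≈ (trans (*-comm P _) ([y-z]x≈yx-zx P r (- (f * g * x * p′))))
      (x∣ʳy⇒x∣ʳzy P (∣-minus-sym p∣h-r)))

  -- `factor-derivative` exhibits n as (n v - v′) u - u′ v; dividing by the unit n gives the Bézout
  -- identity. Only the product rule for this one factorization is required of the primes.
  comaximal-factors : ∀ {u v w u′ v′ w′ n n⁻¹} → u * v ≈ w → w′ ≈ u′ * v + u * v′ →
    n⁻¹ * n ≈ 1# → n + w′ ≈ n * w → Comaximal u v
  comaximal-factors {u} {v} {w} {u′} {v′} {w′} {n} {n⁻¹} uv≈w dw unit e =
    n⁻¹ * (n * v - v′) , n⁻¹ * - u′ , (begin
      n⁻¹ * (n * v - v′) * u + n⁻¹ * - u′ * v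
        ≈⟨ +-cong (*-assoc n⁻¹ _ u) (*-assoc n⁻¹ (- u′) v) ⟩
      n⁻¹ * ((n * v - v′) * u) + n⁻¹ * (- u′ * v)
        ≈⟨ distribˡ n⁻¹ _ _ ⟨
      n⁻¹ * ((n * v - v′) * u + - u′ * v)
        ≈⟨ *-congˡ (+-cong (factor-derivative uv≈w dw e) (sym (-‿distribˡ-* u′ v))) ⟩
      n⁻¹ * (n + u′ * v - u′ * v)
        ≈⟨ *-congˡ (//-rightDividesʳ (u′ * v) n) ⟩
      n⁻¹ * n
        ≈⟨ unit ⟩
      1# ∎)

  -- The numerator of Σ rⱼ / Dⱼ over the common denominator ∏ Dⱼ.
  numerator : ∀ {k} → Vector Carrier k → Vector Carrier k → Carrier
  numerator {zero}  r D = 0#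
  numerator {suc k} r D = r zero * ∏ (tail D) + numerator (tail r) (tail D) * D zero

  -- Every summand of the numerator other than the j-th contains the factor `D j`.
  numerator-mod : ∀ {k} (r D : Vector Carrier (suc k)) j →
    D j ∣ numerator r D - r j * ∏ (removeAt D j)
  numerator-mod r D zero = numerator (tail r) (tail D) ,
    sym (trans (+-congʳ (+-comm _ _)) (//-rightDividesʳ _ _))
  numerator-mod {suc k} r D (suc j) with q , e ← numerator-mod (tail r) (tail D) j =
    r zero * P + q * D zero , (begin
      (r zero * P + q * D zero) * Dⱼ
        ≈⟨ lem₁ (r zero) P (D zero) q Dⱼ ⟩
      r zero * (Dⱼ * P) + D zero * (q * Dⱼ)
        ≈⟨ +-cong (*-congˡ (sym (∏-remove {i = j} (tail D)))) (*-congˡ e) ⟩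
      r zero * ∏ (tail D) + D zero * (numerator (tail r) (tail D) - r (suc j) * P)
        ≈⟨ lem₂ _ (D zero) _ (r (suc j)) P ⟩
      r zero * ∏ (tail D) + numerator (tail r) (tail D) * D zero - r (suc j) * (D zero * P) ∎)
    where
    P = ∏ (removeAt (tail D) j)
    Dⱼ = D (suc j)
    lem₁ = solve 5 (λ r p d q e → (r :* p :+ q :* d) :* e := r :* (e :* p) :+ d :* (q :* e)) refl
    lem₂ : ∀ x d n r p → x + d * (n - r * p) ≈ x + n * d - r * (d * p)
    lem₂ x d n r p = trans (+-congˡ (trans (x[y-z]≈xy-xz d n (r * p))
      (+-cong (*-comm d n) (-‿cong (solve 3 (λ d r p → d :* (r :* p) := r :* (d :* p)) refl d r p)))))
      (sym (+-assoc x (n * d) _))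

  numerator-cong : ∀ {k} (r : Vector Carrier k) {D D′ : Vector Carrier k} →
    (∀ j → D j ≈ D′ j) → numerator r D ≈ numerator r D′
  numerator-cong {zero}  r e = refl
  numerator-cong {suc k} r e =
    +-cong (*-congˡ (∏-cong (e ∘ suc))) (*-cong (numerator-cong (tail r) (e ∘ suc)) (e zero))

  ∏-scale : ∀ {k} c (D : Vector Carrier k) → ∏ (λ j → c * D j) ≈ c ^ k * ∏ D
  ∏-scale {zero}  c D = sym (*-identityˡ 1#)
  ∏-scale {suc k} c D = trans (*-congˡ (∏-scale c (tail D)))
    (*-interchange c (D zero) (c ^ k) (∏ (tail D)))

  -- The numerator is homogeneous of degree k - 1 in D. The extra factor c on the left raises the
  -- exponent to k, so that k = 0 needs no subtraction.
  numerator-scale : ∀ {k} c (r D : Vector Carrier k) →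
    c * numerator r (λ j → c * D j) ≈ c ^ k * numerator r D
  numerator-scale {zero}  c r D = trans (zeroʳ c) (sym (zeroʳ 1#))
  numerator-scale {suc k} c r D = begin
    c * (r zero * ∏ (λ j → c * D (suc j)) + N′ * (c * D zero))
      ≈⟨ lem₁ c (r zero) _ N′ (D zero) ⟩
    c * (r zero * ∏ (λ j → c * D (suc j))) + c * N′ * (c * D zero)
      ≈⟨ +-cong (*-congˡ (*-congˡ (∏-scale c (tail D))))
           (*-congʳ (numerator-scale c (tail r) (tail D))) ⟩
    c * (r zero * (c ^ k * ∏ (tail D))) + c ^ k * N * (c * D zero)
      ≈⟨ lem₂ c (r zero) (c ^ k) (∏ (tail D)) N (D zero) ⟩
    c * c ^ k * (r zero * ∏ (tail D) + N * D zero) ∎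
    where
    N  = numerator (tail r) (tail D)
    N′ = numerator (tail r) (λ j → c * D (suc j))
    lem₁ = solve 5 (λ c r p n d → c :* (r :* p :+ n :* (c :* d))
      := c :* (r :* p) :+ c :* n :* (c :* d)) refl
    lem₂ = solve 6 (λ c r e p n d → c :* (r :* (e :* p)) :+ e :* n :* (c :* d)
      := c :* e :* (r :* p :+ n :* d)) refl

  -- f / ∏ Dⱼ = Σ rⱼ / (c Dⱼ), cross-multiplied.
  numerator-unscale : ∀ {k c c⁻¹ f} (r D : Vector Carrier k) → c⁻¹ * c ≈ 1# →
    c * f ≈ numerator r D → f * ∏ (λ j → c * D j) ≈ numerator r (λ j → c * D j) * ∏ D
  numerator-unscale {k} {c} {c⁻¹} {f} r D unit cf≈N = begin
    f * ∏ (λ j → c * D j)            ≈⟨ insert _ ⟩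
    c⁻¹ * (c * (f * ∏ (λ j → c * D j)))
      ≈⟨ *-congˡ (begin
        c * (f * ∏ (λ j → c * D j))      ≈⟨ *-assoc c f _ ⟨
        c * f * ∏ (λ j → c * D j)        ≈⟨ *-cong cf≈N (∏-scale c D) ⟩
        numerator r D * (c ^ k * ∏ D)    ≈⟨ *-assoc (numerator r D) (c ^ k) (∏ D) ⟨
        numerator r D * c ^ k * ∏ D      ≈⟨ *-congʳ (*-comm (numerator r D) (c ^ k)) ⟩
        c ^ k * numerator r D * ∏ D      ≈⟨ *-congʳ (numerator-scale c r D) ⟨
        c * N * ∏ D                      ≈⟨ *-assoc c N (∏ D) ⟩
        c * (N * ∏ D)                    ∎) ⟩
    c⁻¹ * (c * (N * ∏ D))            ≈⟨ insert _ ⟨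
    N * ∏ D                          ∎
    where
    N = numerator r (λ j → c * D j)
    insert : ∀ x → x ≈ c⁻¹ * (c * x)
    insert x = trans (sym (*-identityˡ x)) (trans (*-congʳ (sym unit)) (*-assoc c⁻¹ c x))

open import Defs
open import Data.Nat using (ℕ; _<_; NonZero)
open import Data.Rational using (_/_)
open import Data.Vec.Functional using (Vector)
open import Function using (_∘_)
open import Function.Definitions using (Injective)
open import Relation.Binary.PropositionalEquality using (_≡_)
open import Relation.Nullary using (¬_)

-- Gauss's identity: the totients of the divisors of n add up to n.

module TotientSum where
  open import Data.Bool using (if_then_else_)
  open import Data.List using ([]; _∷_; _++_; length; filter; upTo)
  open import Data.List.Properties using (filter-++; length-++; upTo-∷ʳ)
  open import Data.Nat
  open import Data.Nat.Properties
  open import Data.Nat.Divisibility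
  open import Data.Nat.GCD
  open import Data.Nat.Coprimality using (Coprime; coprime?; coprime⇒gcd≡1; gcd≡1⇒coprime)
  open import Data.Sum using (inj₂)
  open import Function using (_∘_; mk⇔)
  open import Relation.Binary.PropositionalEquality
  open import Relation.Nullary using (¬_; Dec; yes; no; does; ⌊_⌋; contradiction)
  open import Relation.Nullary.Decidable using (does-⇔; dec-true; dec-false)
  open import Algebra.Properties.CommutativeSemigroup +-commutativeSemigroup using (interchange)

  ∑ : ℕ → (ℕ → ℕ) → ℕ
  ∑ zero    f = 0
  ∑ (suc n) f = f (suc n) + ∑ n f

  𝟙 : ∀ {p} {P : Set p} → Dec P → ℕ
  𝟙 P? = if does P? then 1 else 0

  module _ {p} {P : Set p} where
    𝟙-true : (P? : Dec P) → P → 𝟙 P? ≡ 1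
    𝟙-true P? x = cong (if_then 1 else 0) (dec-true P? x)

    𝟙-false : (P? : Dec P) → ¬ P → 𝟙 P? ≡ 0
    𝟙-false P? x = cong (if_then 1 else 0) (dec-false P? x)

  ∑-cong : ∀ n {f g} → (∀ i → f (suc i) ≡ g (suc i)) → ∑ n f ≡ ∑ n g
  ∑-cong zero    e = refl
  ∑-cong (suc n) e = cong₂ _+_ (e n) (∑-cong n e)

  ∑-0 : ∀ n → ∑ n (λ _ → 0) ≡ 0
  ∑-0 zero    = refl
  ∑-0 (suc n) = ∑-0 n

  ∑-1 : ∀ n → ∑ n (λ _ → 1) ≡ n
  ∑-1 zero    = refl
  ∑-1 (suc n) = cong suc (∑-1 n)

  ∑-+ : ∀ n f g → ∑ n (λ i → f i + g i) ≡ ∑ n f + ∑ n g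
  ∑-+ zero    f g = refl
  ∑-+ (suc n) f g = trans (cong (f (suc n) + g (suc n) +_) (∑-+ n f g))
    (interchange (f (suc n)) (g (suc n)) (∑ n f) (∑ n g))

  ∑-comm : ∀ m n (f : ℕ → ℕ → ℕ) → ∑ m (λ i → ∑ n (f i)) ≡ ∑ n (λ j → ∑ m (λ i → f i j))
  ∑-comm zero    n f = sym (∑-0 n)
  ∑-comm (suc m) n f = trans (cong (∑ n (f (suc m)) +_) (∑-comm m n f))
    (sym (∑-+ n (f (suc m)) _))

  ∑-++-0 : ∀ m n f → (∀ i → i < m → f (suc i + n) ≡ 0) → ∑ (m + n) f ≡ ∑ n f
  ∑-++-0 zero    n f e = refl
  ∑-++-0 (suc m) n f e =
    cong₂ _+_ (e m (n<1+n m)) (∑-++-0 m n f (λ i i<m → e i (m<n⇒m<1+n i<m)))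

  ∑-unique : ∀ n {q} f → suc q ≤ n → f (suc q) ≡ 1 → (∀ i → i ≢ q → f (suc i) ≡ 0) → ∑ n f ≡ 1
  ∑-unique (suc n) {q} f q<n one zeros with q ≟ n
  ... | yes refl = cong₂ _+_ one
          (trans (cong (λ k → ∑ k f) (sym (+-identityʳ q)))
            (∑-++-0 q 0 f (λ i i<q → trans (cong f (+-identityʳ (suc i))) (zeros i (<⇒≢ i<q)))))
  ... | no q≢n = cong₂ _+_ (zeros n (q≢n ∘ sym))
          (∑-unique n f (≤∧≢⇒< (s≤s⁻¹ q<n) q≢n) one zeros)

  -- `upTo n` runs over 0, ..., n - 1 while `∑` runs over 1, ..., n; hence the `pred`.
  length-filter-upTo : ∀ {p} {P : ℕ → Set p} (P? : ∀ i → Dec (P i)) n →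
    length (filter P? (upTo n)) ≡ ∑ n (λ i → 𝟙 (P? (pred i)))
  length-filter-upTo P? zero = refl
  length-filter-upTo P? (suc n) = begin
    length (filter P? (upTo (suc n)))
      ≡⟨ cong (length ∘ filter P?) (upTo-∷ʳ n) ⟨
    length (filter P? (upTo n ++ n ∷ []))
      ≡⟨ cong length (filter-++ P? (upTo n) (n ∷ [])) ⟩
    length (filter P? (upTo n) ++ filter P? (n ∷ []))
      ≡⟨ length-++ (filter P? (upTo n)) ⟩
    length (filter P? (upTo n)) + length (filter P? (n ∷ []))
      ≡⟨ +-comm (length (filter P? (upTo n))) _ ⟩
    length (filter P? (n ∷ [])) + length (filter P? (upTo n))
      ≡⟨ cong₂ _+_ singleton (length-filter-upTo P? n) ⟩
    𝟙 (P? n) + ∑ n _ ∎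
    where
    open ≡-Reasoning
    singleton : length (filter P? (n ∷ [])) ≡ 𝟙 (P? n)
    singleton with P? n
    ... | yes _ = refl
    ... | no _  = refl

  φ-∑ : ∀ n → φ n ≡ ∑ n (λ a → 𝟙 (coprime? a n))
  φ-∑ n = trans (length-filter-upTo (λ a → coprime? (suc a) n) n) (∑-cong n (λ _ → refl))

  -- Same recursion and same divisibility test as `∏Φ∣`, so that a single case split on `suc b ∣? n`
  -- reduces a product of the `Φ e` together with its degree.
  divisorSum : ℕ → ℕ → (ℕ → ℕ) → ℕ
  divisorSum n b f = ∑ b (λ e → if ⌊ e ∣? n ⌋ then f e else 0)

  -- Among 1, …, ec the numbers a with gcd(a, ec) = c are the bc with b ≤ e coprime to e.
  ∑-gcd : ∀ e c .{{_ : NonZero e}} .{{_ : NonZero c}} N →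
    ∑ (N * c) (λ a → 𝟙 (gcd a (e * c) * e ≟ e * c)) ≡ ∑ N (λ b → 𝟙 (coprime? b e))
  ∑-gcd e c zero = refl
  ∑-gcd e c@(suc c′) (suc N) = cong₂ _+_
    (cong (if_then 1 else 0) (does-⇔ (mk⇔ to from) (gcd (suc N * c) (e * c) * e ≟ e * c) (coprime? (suc N) e)))
    (trans (∑-++-0 c′ (N * c) _ vanish) (∑-gcd e c N))
    where
    scale : gcd (suc N * c) (e * c) ≡ gcd (suc N) e * c
    scale = trans (cong₂ gcd (*-comm (suc N) c) (*-comm e c))
      (trans (sym (c*gcd[m,n]≡gcd[cm,cn] c (suc N) e)) (*-comm c _))
    cancel : ∀ {x} → x * e ≡ e * c → x ≡ c
    cancel {x} eq = *-cancelʳ-≡ x c e (trans eq (*-comm e c))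
    to : gcd (suc N * c) (e * c) * e ≡ e * c → Coprime (suc N) e
    to eq = gcd≡1⇒coprime (*-cancelʳ-≡ _ 1 c
      (trans (sym scale) (trans (cancel eq) (sym (*-identityˡ c)))))
    from : Coprime (suc N) e → gcd (suc N * c) (e * c) * e ≡ e * c
    from co = trans (cong (_* e) (trans scale (trans (cong (_* c) (coprime⇒gcd≡1 co)) (*-identityˡ c))))
      (*-comm c e)
    vanish : ∀ i → i < c′ → 𝟙 (gcd (suc i + N * c) (e * c) * e ≟ e * c) ≡ 0
    vanish i i<c′ = 𝟙-false (_ ≟ _) λ eq →
      <⇒≱ (s<s i<c′) (∣⇒≤ (∣m+n∣m⇒∣n
        (subst (c ∣_) (+-comm (suc i) (N * c))
          (subst (_∣ suc i + N * c) (cancel eq) (gcd[m,n]∣m (suc i + N * c) (e * c))))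
        (n∣m*n N)))

  -- The condition gcd(a, n) = n / e is written as gcd(a, n) e = n: this needs no division, and it
  -- fails for every a when e does not divide n.
  ∑-gcd-divisor : ∀ n .{{_ : NonZero n}} e .{{_ : NonZero e}} →
    (if ⌊ e ∣? n ⌋ then φ e else 0) ≡ ∑ n (λ a → 𝟙 (gcd a n * e ≟ n))
  ∑-gcd-divisor n e with e ∣? n
  ... | no e∤n = sym (trans (∑-cong n (λ i → 𝟙-false (gcd (suc i) n * e ≟ n) (λ eq → e∤n (divides (gcd (suc i) n) (sym eq))))) (∑-0 n))
  ... | yes (divides zero refl) = contradiction refl (≢-nonZero⁻¹ n)
  ... | yes (divides c@(suc _) refl) = trans (φ-∑ e)
    (trans (sym (∑-gcd e c e)) (cong (λ n → ∑ n (λ a → 𝟙 (gcd a n * e ≟ n))) (*-comm e c)))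

  -- The only e that counts is the cofactor n / gcd(a, n), which is at most n.
  ∑-gcd-unique : ∀ n .{{_ : NonZero n}} a → ∑ n (λ e → 𝟙 (gcd a n * e ≟ n)) ≡ 1
  ∑-gcd-unique n a with gcd[m,n]∣n a n
  ... | divides zero n≡0 = contradiction n≡0 (≢-nonZero⁻¹ n)
  ... | divides q@(suc q′) n≡qg = ∑-unique n (λ e → 𝟙 (g * e ≟ n)) (∣⇒≤ (divides g (trans n≡qg (*-comm q g))))
      (𝟙-true (_ ≟ _) (trans (*-comm g q) (sym n≡qg)))
      (λ i i≢q → 𝟙-false (_ ≟ _) (λ eq → i≢q (suc-injective
        (*-cancelˡ-≡ (suc i) q g (trans eq (trans n≡qg (*-comm q g)))))))
    where
    g = gcd a n
    instance
      g≢0 : NonZero g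
      g≢0 = ≢-nonZero (gcd[m,n]≢0 a n (inj₂ (≢-nonZero⁻¹ n)))

  -- Double counting of the pairs (a, e) with gcd(a, n) e = n: a divisor e occurs in φ(e) of them,
  -- and each a in exactly one.
  ∑-φ : ∀ n .{{_ : NonZero n}} → divisorSum n n φ ≡ n
  ∑-φ n = begin
    ∑ n (λ e → if ⌊ e ∣? n ⌋ then φ e else 0)    ≡⟨ ∑-cong n (λ e → ∑-gcd-divisor n (suc e)) ⟩
    ∑ n (λ e → ∑ n (λ a → 𝟙 (gcd a n * e ≟ n)))     ≡⟨ ∑-comm n n (λ e a → 𝟙 (gcd a n * e ≟ n)) ⟩
    ∑ n (λ a → ∑ n (λ e → 𝟙 (gcd a n * e ≟ n)))     ≡⟨ ∑-cong n (λ a → ∑-gcd-unique n (suc a)) ⟩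
    ∑ n (λ _ → 1)                                   ≡⟨ ∑-1 n ⟩
    n                                               ∎
    where open ≡-Reasoning

-- The commutative ring ℚ[x] and its derivative.

module Polynomial where
  open import Algebra.Bundles using (AbelianGroup)
  open import Algebra.Structures using (IsAbelianGroup)
  open import Data.List using ([]; _∷_)
  open import Data.Nat using (ℕ; zero; suc)
  open import Data.Product using (_,_)
  open import Data.Rational as ℚ using (ℚ; 0ℚ; 1ℚ; _+_; _*_; -_)
  open import Data.Rational.Properties as ℚ using ()
  open import Relation.Binary.PropositionalEquality
  open import Relation.Binary.Structures using (IsEquivalence)
  open import Relation.Binary.Bundles using (Setoid)

  ≈-isEquivalence : IsEquivalence _≈_
  ≈-isEquivalence = record
    { refl  = mk≈ λ _ → refl
    ; sym   = λ e → mk≈ λ n → sym (coeff-≡ e n)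
    ; trans = λ e e′ → mk≈ λ n → trans (coeff-≡ e n) (coeff-≡ e′ n)
    }

  open IsEquivalence ≈-isEquivalence public
    using () renaming (refl to ≈-refl; sym to ≈-sym; trans to ≈-trans; reflexive to ≈-reflexive)

  polySetoid : Setoid _ _
  polySetoid = record { isEquivalence = ≈-isEquivalence }

  open import Relation.Binary.Reasoning.Setoid polySetoid

  ∷-cong : ∀ {a b p q} → a ≡ b → p ≈ q → a ∷ p ≈ b ∷ q
  ∷-cong a≡b p≈q = mk≈ λ { zero → a≡b ; (suc n) → coeff-≡ p≈q n }

  tail-≈ : ∀ {a b p q} → a ∷ p ≈ b ∷ q → p ≈ q
  tail-≈ e = mk≈ λ n → coeff-≡ e (suc n)

  0∷-≈0 : ∀ {a p} → a ≡ 0ℚ → p ≈ 0ᵖ → a ∷ p ≈ 0ᵖ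
  0∷-≈0 a≡0 p≈0 = mk≈ λ { zero → a≡0 ; (suc n) → coeff-≡ p≈0 n }

  coeff--ᵖ : ∀ p n → coeff (-ᵖ p) n ≡ - coeff p n
  coeff--ᵖ []      n       = refl
  coeff--ᵖ (a ∷ p) zero    = refl
  coeff--ᵖ (a ∷ p) (suc n) = coeff--ᵖ p n

  +ᵖ-cong : ∀ {p p′ q q′} → p ≈ p′ → q ≈ q′ → p +ᵖ q ≈ p′ +ᵖ q′
  +ᵖ-cong {p} {p′} {q} {q′} e e′ = mk≈ λ n →
    trans (coeff-+ᵖ p q n) (trans (cong₂ _+_ (coeff-≡ e n) (coeff-≡ e′ n)) (sym (coeff-+ᵖ p′ q′ n)))

  +ᵖ-comm : ∀ p q → p +ᵖ q ≈ q +ᵖ p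
  +ᵖ-comm p q = mk≈ λ n →
    trans (coeff-+ᵖ p q n) (trans (ℚ.+-comm (coeff p n) (coeff q n)) (sym (coeff-+ᵖ q p n)))

  +ᵖ-assoc : ∀ p q r → (p +ᵖ q) +ᵖ r ≈ p +ᵖ (q +ᵖ r)
  +ᵖ-assoc p q r = mk≈ λ n → trans (trans (coeff-+ᵖ (p +ᵖ q) r n) (cong (_+ coeff r n) (coeff-+ᵖ p q n)))
    (trans (ℚ.+-assoc (coeff p n) (coeff q n) (coeff r n))
      (sym (trans (coeff-+ᵖ p (q +ᵖ r) n) (cong (coeff p n +_) (coeff-+ᵖ q r n)))))

  +ᵖ-identityʳ : ∀ p → p +ᵖ 0ᵖ ≈ p
  +ᵖ-identityʳ p = +ᵖ-comm p 0ᵖ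

  -ᵖ-inverseʳ : ∀ p → p +ᵖ -ᵖ p ≈ 0ᵖ
  -ᵖ-inverseʳ p = mk≈ λ n → trans (coeff-+ᵖ p (-ᵖ p) n)
    (trans (cong (coeff p n +_) (coeff--ᵖ p n)) (ℚ.+-inverseʳ (coeff p n)))

  -ᵖ-cong : ∀ {p q} → p ≈ q → -ᵖ p ≈ -ᵖ q
  -ᵖ-cong {p} {q} e = mk≈ λ n →
    trans (coeff--ᵖ p n) (trans (cong -_ (coeff-≡ e n)) (sym (coeff--ᵖ q n)))

  +ᵖ-congˡ : ∀ p {q q′} → q ≈ q′ → p +ᵖ q ≈ p +ᵖ q′
  +ᵖ-congˡ p = +ᵖ-cong (≈-refl {p})

  +ᵖ-congʳ : ∀ q {p p′} → p ≈ p′ → p +ᵖ q ≈ p′ +ᵖ q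
  +ᵖ-congʳ q e = +ᵖ-cong e (≈-refl {q})

  +ᵖ-isAbelianGroup : IsAbelianGroup _≈_ _+ᵖ_ 0ᵖ (-ᵖ_)
  +ᵖ-isAbelianGroup = record
    { isGroup = record
      { isMonoid = record
        { isSemigroup = record
          { isMagma = record { isEquivalence = ≈-isEquivalence ; ∙-cong = +ᵖ-cong }
          ; assoc = +ᵖ-assoc
          }
        ; identity = (λ p → ≈-refl) , +ᵖ-identityʳ
        }
      ; inverse = (λ p → ≈-trans (+ᵖ-comm (-ᵖ p) p) (-ᵖ-inverseʳ p)) , -ᵖ-inverseʳ
      ; ⁻¹-cong = -ᵖ-cong
      }
    ; comm = +ᵖ-comm
    }

  +ᵖ-abelianGroup : AbelianGroup _ _
  +ᵖ-abelianGroup = record { isAbelianGroup = +ᵖ-isAbelianGroup }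

  open import Algebra.Properties.CommutativeSemigroup (AbelianGroup.commutativeSemigroup +ᵖ-abelianGroup)
    using (x∙yz≈y∙xz) renaming (interchange to +ᵖ-interchange)

  ·ᵖ-cong : ∀ {a b p q} → a ≡ b → p ≈ q → a ·ᵖ p ≈ b ·ᵖ q
  ·ᵖ-cong {a} {b} {p} {q} a≡b e = mk≈ λ n →
    trans (coeff-·ᵖ a p n) (trans (cong₂ _*_ a≡b (coeff-≡ e n)) (sym (coeff-·ᵖ b q n)))

  ·ᵖ-distribʳ : ∀ a b p → (a + b) ·ᵖ p ≈ a ·ᵖ p +ᵖ b ·ᵖ p
  ·ᵖ-distribʳ a b p = mk≈ λ n → trans (coeff-·ᵖ (a + b) p n) (trans (ℚ.*-distribʳ-+ (coeff p n) a b)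
    (sym (trans (coeff-+ᵖ (a ·ᵖ p) (b ·ᵖ p) n) (cong₂ _+_ (coeff-·ᵖ a p n) (coeff-·ᵖ b p n)))))

  ·ᵖ-distribˡ : ∀ a p q → a ·ᵖ (p +ᵖ q) ≈ a ·ᵖ p +ᵖ a ·ᵖ q
  ·ᵖ-distribˡ a p q = mk≈ λ n →
    trans (coeff-·ᵖ a (p +ᵖ q) n) (trans (cong (a *_) (coeff-+ᵖ p q n))
      (trans (ℚ.*-distribˡ-+ a (coeff p n) (coeff q n))
        (sym (trans (coeff-+ᵖ (a ·ᵖ p) (a ·ᵖ q) n) (cong₂ _+_ (coeff-·ᵖ a p n) (coeff-·ᵖ a q n))))))

  ·ᵖ-assoc : ∀ a b p → (a * b) ·ᵖ p ≈ a ·ᵖ (b ·ᵖ p)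
  ·ᵖ-assoc a b p = mk≈ λ n → trans (coeff-·ᵖ (a * b) p n) (trans (ℚ.*-assoc a b (coeff p n))
    (sym (trans (coeff-·ᵖ a (b ·ᵖ p) n) (cong (a *_) (coeff-·ᵖ b p n)))))

  1·ᵖ : ∀ p → 1ℚ ·ᵖ p ≈ p
  1·ᵖ p = mk≈ λ n → trans (coeff-·ᵖ 1ℚ p n) (ℚ.*-identityˡ (coeff p n))

  0·ᵖ : ∀ p → 0ℚ ·ᵖ p ≈ 0ᵖ
  0·ᵖ p = mk≈ λ n → trans (coeff-·ᵖ 0ℚ p n) (ℚ.*-zeroˡ (coeff p n))

  *ᵖ-congˡ : ∀ p {q q′} → q ≈ q′ → p *ᵖ q ≈ p *ᵖ q′
  *ᵖ-congˡ []      e = ≈-refl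
  *ᵖ-congˡ (a ∷ p) e = +ᵖ-cong (·ᵖ-cong {a} refl e) (∷-cong refl (*ᵖ-congˡ p e))

  *ᵖ-zeroʳ : ∀ p → p *ᵖ 0ᵖ ≈ 0ᵖ
  *ᵖ-zeroʳ []      = ≈-refl
  *ᵖ-zeroʳ (a ∷ p) = 0∷-≈0 refl (*ᵖ-zeroʳ p)

  -- `_*ᵖ_` recurses on its left factor only. This is the mirror recursion on the right factor, from
  -- which commutativity follows by induction.
  *ᵖ-∷ : ∀ p b q → p *ᵖ (b ∷ q) ≈ b ·ᵖ p +ᵖ (0ℚ ∷ p *ᵖ q)
  *ᵖ-∷ []      b q = ≈-sym (0∷-≈0 refl ≈-refl)
  *ᵖ-∷ (a ∷ p) b q = ∷-cong (cong (_+ 0ℚ) (ℚ.*-comm a b)) (begin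
    a ·ᵖ q +ᵖ p *ᵖ (b ∷ q)                  ≈⟨ +ᵖ-congˡ (a ·ᵖ q) (*ᵖ-∷ p b q) ⟩
    a ·ᵖ q +ᵖ (b ·ᵖ p +ᵖ (0ℚ ∷ p *ᵖ q))     ≈⟨ +ᵖ-assoc (a ·ᵖ q) (b ·ᵖ p) _ ⟨
    (a ·ᵖ q +ᵖ b ·ᵖ p) +ᵖ (0ℚ ∷ p *ᵖ q)     ≈⟨ +ᵖ-congʳ (0ℚ ∷ p *ᵖ q) (+ᵖ-comm (a ·ᵖ q) (b ·ᵖ p)) ⟩
    (b ·ᵖ p +ᵖ a ·ᵖ q) +ᵖ (0ℚ ∷ p *ᵖ q)     ≈⟨ +ᵖ-assoc (b ·ᵖ p) (a ·ᵖ q) _ ⟩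
    b ·ᵖ p +ᵖ (a ·ᵖ q +ᵖ (0ℚ ∷ p *ᵖ q))     ∎)

  *ᵖ-comm : ∀ p q → p *ᵖ q ≈ q *ᵖ p
  *ᵖ-comm []      q = ≈-sym (*ᵖ-zeroʳ q)
  *ᵖ-comm (a ∷ p) q = ≈-trans (+ᵖ-congˡ (a ·ᵖ q) (∷-cong refl (*ᵖ-comm p q))) (≈-sym (*ᵖ-∷ q a p))

  *ᵖ-cong : ∀ {p p′ q q′} → p ≈ p′ → q ≈ q′ → p *ᵖ q ≈ p′ *ᵖ q′
  *ᵖ-cong {p} {p′} {q} {q′} e e′ = begin
    p *ᵖ q    ≈⟨ *ᵖ-congˡ p e′ ⟩
    p *ᵖ q′   ≈⟨ *ᵖ-comm p q′ ⟩
    q′ *ᵖ p   ≈⟨ *ᵖ-congˡ q′ e ⟩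
    q′ *ᵖ p′  ≈⟨ *ᵖ-comm q′ p′ ⟩
    p′ *ᵖ q′  ∎

  *ᵖ-distribʳ : ∀ q p p′ → (p +ᵖ p′) *ᵖ q ≈ p *ᵖ q +ᵖ p′ *ᵖ q
  *ᵖ-distribʳ q []      p′       = ≈-refl
  *ᵖ-distribʳ q (a ∷ p) []       = ≈-sym (+ᵖ-identityʳ _)
  *ᵖ-distribʳ q (a ∷ p) (b ∷ p′) = begin
    (a + b) ·ᵖ q +ᵖ (0ℚ ∷ (p +ᵖ p′) *ᵖ q)
      ≈⟨ +ᵖ-cong (·ᵖ-distribʳ a b q) (∷-cong refl (*ᵖ-distribʳ q p p′)) ⟩
    (a ·ᵖ q +ᵖ b ·ᵖ q) +ᵖ ((0ℚ ∷ p *ᵖ q) +ᵖ (0ℚ ∷ p′ *ᵖ q))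
      ≈⟨ +ᵖ-interchange (a ·ᵖ q) (b ·ᵖ q) _ _ ⟩
    (a ·ᵖ q +ᵖ (0ℚ ∷ p *ᵖ q)) +ᵖ (b ·ᵖ q +ᵖ (0ℚ ∷ p′ *ᵖ q)) ∎

  ·ᵖ-*ᵖ : ∀ a p q → (a ·ᵖ p) *ᵖ q ≈ a ·ᵖ (p *ᵖ q)
  ·ᵖ-*ᵖ a []      q = ≈-refl
  ·ᵖ-*ᵖ a (b ∷ p) q = begin
    (a * b) ·ᵖ q +ᵖ (0ℚ ∷ (a ·ᵖ p) *ᵖ q)
      ≈⟨ +ᵖ-cong (·ᵖ-assoc a b q) (∷-cong (sym (ℚ.*-zeroʳ a)) (·ᵖ-*ᵖ a p q)) ⟩
    a ·ᵖ (b ·ᵖ q) +ᵖ a ·ᵖ (0ℚ ∷ p *ᵖ q)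
      ≈⟨ ·ᵖ-distribˡ a (b ·ᵖ q) _ ⟨
    a ·ᵖ (b ·ᵖ q +ᵖ (0ℚ ∷ p *ᵖ q)) ∎

  0∷-*ᵖ : ∀ p q → (0ℚ ∷ p) *ᵖ q ≈ 0ℚ ∷ p *ᵖ q
  0∷-*ᵖ p q = +ᵖ-congʳ (0ℚ ∷ p *ᵖ q) (0·ᵖ q)

  *ᵖ-assoc : ∀ p q r → (p *ᵖ q) *ᵖ r ≈ p *ᵖ (q *ᵖ r)
  *ᵖ-assoc []      q r = ≈-refl
  *ᵖ-assoc (a ∷ p) q r = begin
    (a ·ᵖ q +ᵖ (0ℚ ∷ p *ᵖ q)) *ᵖ r           ≈⟨ *ᵖ-distribʳ r (a ·ᵖ q) _ ⟩
    (a ·ᵖ q) *ᵖ r +ᵖ (0ℚ ∷ p *ᵖ q) *ᵖ r      ≈⟨ +ᵖ-cong (·ᵖ-*ᵖ a q r) (0∷-*ᵖ (p *ᵖ q) r) ⟩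
    a ·ᵖ (q *ᵖ r) +ᵖ (0ℚ ∷ (p *ᵖ q) *ᵖ r)    ≈⟨ +ᵖ-congˡ (a ·ᵖ (q *ᵖ r)) (∷-cong refl (*ᵖ-assoc p q r)) ⟩
    a ·ᵖ (q *ᵖ r) +ᵖ (0ℚ ∷ p *ᵖ (q *ᵖ r))    ∎

  const : ℚ → Poly
  const c = c ∷ []

  const-*ᵖ : ∀ c p → const c *ᵖ p ≈ c ·ᵖ p
  const-*ᵖ c p = ≈-trans (+ᵖ-congˡ (c ·ᵖ p) (0∷-≈0 refl ≈-refl)) (+ᵖ-identityʳ (c ·ᵖ p))

  *ᵖ-identityˡ : ∀ p → 1ᵖ *ᵖ p ≈ p
  *ᵖ-identityˡ p = ≈-trans (const-*ᵖ 1ℚ p) (1·ᵖ p)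

  polyRing : CommutativeRing _ _
  polyRing = record
    { Carrier = Poly
    ; _≈_ = _≈_
    ; _+_ = _+ᵖ_
    ; _*_ = _*ᵖ_
    ; -_ = -ᵖ_
    ; 0# = 0ᵖ
    ; 1# = 1ᵖ
    ; isCommutativeRing = record
      { isRing = record
        { +-isAbelianGroup = +ᵖ-isAbelianGroup
        ; *-cong = *ᵖ-cong
        ; *-assoc = *ᵖ-assoc
        ; *-identity = *ᵖ-identityˡ , λ p → ≈-trans (*ᵖ-comm p 1ᵖ) (*ᵖ-identityˡ p)
        ; distrib = (λ p q r → ≈-trans (*ᵖ-comm p (q +ᵖ r))
                      (≈-trans (*ᵖ-distribʳ p q r) (+ᵖ-cong (*ᵖ-comm q p) (*ᵖ-comm r p))))
                  , *ᵖ-distribʳ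
        }
      ; *-comm = *ᵖ-comm
      }
    }

  -- Lists related by `_≈_` may differ in length, so the mixed cases must show that the derivative
  -- of a list of zeros vanishes.
  derivative-cong : ∀ {p q} → p ≈ q → derivative p ≈ derivative q
  derivative-cong {[]}    {[]}    e = ≈-refl
  derivative-cong {[]}    {b ∷ q} e = ≈-sym (derivative-0 (b ∷ q) (≈-sym e))
    where
    derivative-0 : ∀ q → q ≈ 0ᵖ → derivative q ≈ 0ᵖ
    derivative-0 []      e = ≈-refl
    derivative-0 (b ∷ q) e = +ᵖ-cong q≈0 (0∷-≈0 refl (derivative-0 q q≈0))
      where
      q≈0 : q ≈ 0ᵖ
      q≈0 = mk≈ λ n → coeff-≡ e (suc n)
  derivative-cong {a ∷ p} {[]}    e = ≈-sym (derivative-cong {[]} {a ∷ p} (≈-sym e))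
  derivative-cong {a ∷ p} {b ∷ q} e = +ᵖ-cong (tail-≈ e) (∷-cong refl (derivative-cong (tail-≈ e)))

  derivative-+ᵖ : ∀ p q → derivative (p +ᵖ q) ≈ derivative p +ᵖ derivative q
  derivative-+ᵖ []      q       = ≈-refl
  derivative-+ᵖ (a ∷ p) []      = ≈-sym (+ᵖ-identityʳ _)
  derivative-+ᵖ (a ∷ p) (b ∷ q) = begin
    (p +ᵖ q) +ᵖ (0ℚ ∷ derivative (p +ᵖ q))
      ≈⟨ +ᵖ-congˡ (p +ᵖ q) (∷-cong refl (derivative-+ᵖ p q)) ⟩
    (p +ᵖ q) +ᵖ ((0ℚ ∷ derivative p) +ᵖ (0ℚ ∷ derivative q))
      ≈⟨ +ᵖ-interchange p q _ _ ⟩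
    (p +ᵖ (0ℚ ∷ derivative p)) +ᵖ (q +ᵖ (0ℚ ∷ derivative q)) ∎

  derivative-·ᵖ : ∀ c p → derivative (c ·ᵖ p) ≈ c ·ᵖ derivative p
  derivative-·ᵖ c []      = ≈-refl
  derivative-·ᵖ c (a ∷ p) = begin
    c ·ᵖ p +ᵖ (0ℚ ∷ derivative (c ·ᵖ p))
      ≈⟨ +ᵖ-congˡ (c ·ᵖ p) (∷-cong (sym (ℚ.*-zeroʳ c)) (derivative-·ᵖ c p)) ⟩
    c ·ᵖ p +ᵖ c ·ᵖ (0ℚ ∷ derivative p)
      ≈⟨ ·ᵖ-distribˡ c p _ ⟨
    c ·ᵖ (p +ᵖ (0ℚ ∷ derivative p)) ∎

  -- Differentiating x p q leaves a stray term p q; together with x p′ q it forms (p + x p′) q,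
  -- which is (a + x p)′ q.
  derivative-*ᵖ : ∀ p q → derivative (p *ᵖ q) ≈ derivative p *ᵖ q +ᵖ p *ᵖ derivative q
  derivative-*ᵖ []      q = ≈-refl
  derivative-*ᵖ (a ∷ p) q = begin
    derivative (a ·ᵖ q +ᵖ (0ℚ ∷ p *ᵖ q))
      ≈⟨ derivative-+ᵖ (a ·ᵖ q) _ ⟩
    derivative (a ·ᵖ q) +ᵖ (p *ᵖ q +ᵖ (0ℚ ∷ derivative (p *ᵖ q)))
      ≈⟨ +ᵖ-cong (derivative-·ᵖ a q) (+ᵖ-congˡ (p *ᵖ q) (∷-cong refl (derivative-*ᵖ p q))) ⟩
    a ·ᵖ q′ +ᵖ (p *ᵖ q +ᵖ (xp′q +ᵖ xpq′))
      ≈⟨ +ᵖ-congˡ (a ·ᵖ q′) (+ᵖ-assoc (p *ᵖ q) xp′q xpq′) ⟨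
    a ·ᵖ q′ +ᵖ ((p *ᵖ q +ᵖ xp′q) +ᵖ xpq′)
      ≈⟨ x∙yz≈y∙xz (a ·ᵖ q′) (p *ᵖ q +ᵖ xp′q) xpq′ ⟩
    (p *ᵖ q +ᵖ xp′q) +ᵖ (a ·ᵖ q′ +ᵖ xpq′)
      ≈⟨ +ᵖ-congʳ ((a ∷ p) *ᵖ q′) (+ᵖ-congˡ (p *ᵖ q) (0∷-*ᵖ p′ q)) ⟨
    (p *ᵖ q +ᵖ (0ℚ ∷ p′) *ᵖ q) +ᵖ (a ∷ p) *ᵖ q′
      ≈⟨ +ᵖ-congʳ ((a ∷ p) *ᵖ q′) (*ᵖ-distribʳ q p (0ℚ ∷ p′)) ⟨
    (p +ᵖ (0ℚ ∷ p′)) *ᵖ q +ᵖ (a ∷ p) *ᵖ q′ ∎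
    where
    p′ = derivative p
    q′ = derivative q
    xp′q = 0ℚ ∷ p′ *ᵖ q
    xpq′ = 0ℚ ∷ p *ᵖ q′

-- Degrees and Euclidean division.

module Degree where
  open Polynomial
  open import Data.List using ([]; _∷_)
  open import Data.Nat as ℕ using (ℕ; zero; suc; z≤n; s≤s; _≤_; _<_)
  import Data.Nat.Properties as ℕ
  open import Data.Product using (_,_)
  open import Data.Rational as ℚ using (ℚ; 0ℚ; 1ℚ; _+_; _*_; -_; _-_; ≢-nonZero)
  open import Data.Rational.Properties as ℚ using (_≟_)
  open import Relation.Binary.PropositionalEquality
  open import Relation.Nullary using (yes; no; contradiction)
  open Comaximality polyRing
  open import Algebra.Properties.Ring (CommutativeRing.ring polyRing) using (x≈z//y; //-rightDividesˡ)
  open import Relation.Binary.Reasoning.Setoid polySetoid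

  -- `deg` does not separate zero from the nonzero constants. A strict bound does: the bound 0 means
  -- that p is zero.
  record DegreeBelow (p : Poly) (n : ℕ) : Set where
    constructor degreeBelow
    field vanish : ∀ i → n ≤ i → coeff p i ≡ 0ℚ

  open DegreeBelow

  record HasDegree (p : Poly) (n : ℕ) : Set where
    constructor hasDegree
    field
      below : DegreeBelow p (suc n)
      top≢0 : coeff p n ≢ 0ℚ

  open HasDegree

  below-mono : ∀ {p m n} → m ≤ n → DegreeBelow p m → DegreeBelow p n
  below-mono m≤n b = degreeBelow λ i n≤i → vanish b i (ℕ.≤-trans m≤n n≤i)

  below-≈ : ∀ {p q n} → p ≈ q → DegreeBelow p n → DegreeBelow q n
  below-≈ p≈q b = degreeBelow λ i n≤i → trans (sym (coeff-≡ p≈q i)) (vanish b i n≤i)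

  below-+ᵖ : ∀ p q {n} → DegreeBelow p n → DegreeBelow q n → DegreeBelow (p +ᵖ q) n
  below-+ᵖ p q b c = degreeBelow λ i n≤i →
    trans (coeff-+ᵖ p q i) (cong₂ _+_ (vanish b i n≤i) (vanish c i n≤i))

  below--ᵖ : ∀ p {n} → DegreeBelow p n → DegreeBelow (-ᵖ p) n
  below--ᵖ p b = degreeBelow λ i n≤i → trans (coeff--ᵖ p i) (cong -_ (vanish b i n≤i))

  below-tail : ∀ {a p n} → DegreeBelow (a ∷ p) (suc n) → DegreeBelow p n
  below-tail b = degreeBelow λ i n≤i → vanish b (suc i) (s≤s n≤i)

  below-0 : ∀ {p} → DegreeBelow p 0 → p ≈ 0ᵖ
  below-0 b = mk≈ λ i → vanish b i z≤n

  coeff-*ᵖ-above : ∀ a p {q n} i → DegreeBelow q n → n ≤ suc i →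
    coeff ((a ∷ p) *ᵖ q) (suc i) ≡ coeff (p *ᵖ q) i
  coeff-*ᵖ-above a p {q} i b n≤i = trans (coeff-∷*ᵖ a p q (suc i))
    (trans (cong (λ c → a * c + coeff (p *ᵖ q) i) (vanish b (suc i) n≤i))
      (trans (cong (_+ coeff (p *ᵖ q) i) (ℚ.*-zeroʳ a)) (ℚ.+-identityˡ _)))

  -- The bounds are asymmetric, deg p < m and deg q ≤ n, to avoid subtraction while including p = 0.
  -- This form serves both a product of exact degrees and a remainder times a product.
  below-*ᵖ : ∀ p q {m n} → DegreeBelow p m → DegreeBelow q (suc n) → DegreeBelow (p *ᵖ q) (m ℕ.+ n)
  below-*ᵖ p       q {zero}  b c = below-≈ (≈-sym (*ᵖ-cong (below-0 b) (≈-refl {q}))) (degreeBelow λ _ _ → refl)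
  below-*ᵖ []      q {suc m} b c = degreeBelow λ _ _ → refl
  below-*ᵖ (a ∷ p) q {suc m} b c = degreeBelow λ where
    (suc i) (s≤s m+n≤i) →
      trans (coeff-*ᵖ-above a p i c (s≤s (ℕ.m+n≤o⇒n≤o m m+n≤i)))
        (vanish (below-*ᵖ p q (below-tail b) c) i m+n≤i)

  coeff-*ᵖ-top : ∀ p q m n → DegreeBelow p (suc m) → DegreeBelow q (suc n) →
    coeff (p *ᵖ q) (m ℕ.+ n) ≡ coeff p m * coeff q n
  coeff-*ᵖ-top []      q m       n b c = sym (ℚ.*-zeroˡ (coeff q n))
  coeff-*ᵖ-top (a ∷ p) q zero    n b c = trans (coeff-∷*ᵖ a p q n)
    (trans (cong (a * coeff q n +_) (coeff-≡ {0ℚ ∷ p *ᵖ q} (0∷-≈0 refl (*ᵖ-cong (below-0 (below-tail b)) (≈-refl {q}))) n))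
      (ℚ.+-identityʳ _))
  coeff-*ᵖ-top (a ∷ p) q (suc m) n b c =
    trans (coeff-*ᵖ-above a p (m ℕ.+ n) c (s≤s (ℕ.m≤n+m n m)))
      (coeff-*ᵖ-top p q m n (below-tail b) c)

  hasDegree-≉0 : ∀ {p n} → HasDegree p n → p ≉ 0ᵖ
  hasDegree-≉0 {n = n} h p≈0 = top≢0 h (coeff-≡ p≈0 n)

  hasDegree-≈ : ∀ {p q n} → p ≈ q → HasDegree p n → HasDegree q n
  hasDegree-≈ {n = n} p≈q h = hasDegree (below-≈ p≈q (below h)) λ e → top≢0 h (trans (coeff-≡ p≈q n) e)

  hasDegree-*ᵖ : ∀ {p q m n} → HasDegree p m → HasDegree q n → HasDegree (p *ᵖ q) (m ℕ.+ n)
  hasDegree-*ᵖ {p} {q} {m} {n} h k = hasDegree (below-*ᵖ p q (below h) (below k))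
    λ e → top≢0 k (*-cancel-0 (top≢0 h) (trans (sym (coeff-*ᵖ-top p q m n (below h) (below k))) e))

  below⇒< : ∀ {p m n} → HasDegree p m → DegreeBelow p n → m < n
  below⇒< {m = m} {n} h b with m ℕ.<? n
  ... | yes m<n = m<n
  ... | no m≮n = contradiction (vanish b m (ℕ.≮⇒≥ m≮n)) (top≢0 h)

  hasDegree-unique : ∀ {p m n} → HasDegree p m → HasDegree p n → m ≡ n
  hasDegree-unique h k = ℕ.≤-antisym (ℕ.s≤s⁻¹ (below⇒< h (below k))) (ℕ.s≤s⁻¹ (below⇒< k (below h)))

  deg-below : ∀ p → DegreeBelow p (suc (deg p))
  deg-below []      = degreeBelow λ _ _ → refl
  deg-below (a ∷ p) with p ≈0?
  ... | yes p≈0 = degreeBelow λ { (suc i) _ → coeff-≡ p≈0 i }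
  ... | no _ = degreeBelow λ { (suc i) (s≤s le) → vanish (deg-below p) i le }

  leading≢0 : ∀ p → p ≉ 0ᵖ → leading p ≢ 0ℚ
  leading≢0 []      p≉0 _ = p≉0 ≈-refl
  leading≢0 (a ∷ p) p≉0 e with p ≈0?
  ... | yes p≈0 = p≉0 (0∷-≈0 e p≈0)
  ... | no p′≉0 = leading≢0 p p′≉0 e

  deg-hasDegree : ∀ {p} → p ≉ 0ᵖ → HasDegree p (deg p)
  deg-hasDegree {p} p≉0 = hasDegree (deg-below p) (leading≢0 p p≉0)

  -- A nonzero cofactor u would give r = u p the degree deg u + n, which is at least n. Both the
  -- exactness of quotients and the final comparison of the two sides rest on this.
  ∣-below⇒≈0 : ∀ {p r n} → HasDegree p n → p ∣ r → DegreeBelow r n → r ≈ 0ᵖ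
  ∣-below⇒≈0 {p} {r} {n} h (u , up≈r) b with u ≈0?
  ... | yes u≈0 = ≈-trans (≈-sym up≈r) (*ᵖ-cong u≈0 (≈-refl {p}))
  ... | no u≉0 = contradiction
    (below⇒< (hasDegree-≈ up≈r (hasDegree-*ᵖ (deg-hasDegree u≉0) h)) b)
    (ℕ.≤⇒≯ (ℕ.m≤n+m n (deg u)))

  recip-inverseˡ : ∀ {c} → c ≢ 0ℚ → recip c * c ≡ 1ℚ
  recip-inverseˡ {c} c≢0 with c ≟ 0ℚ
  ... | yes c≡0 = contradiction c≡0 c≢0
  ... | no c≢0′ = ℚ.*-inverseˡ c {{≢-nonZero c≢0′}}

  -- The multiple t p subtracted from the remainder is the one that t contributes to the quotient,
  -- so the identity holds for any t and even for p ≈ 0ᵖ. The choice of t matters only for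
  -- `rem-below`.
  division : ∀ f p → f ≈ (f quot p) *ᵖ p +ᵖ (f rem p)
  division []      p = ≈-refl
  division (a ∷ f) p = ≈-sym (begin
    (tp +ᵖ (0ℚ ∷ qp)) +ᵖ (s -ᵖ tp)   ≈⟨ +ᵖ-comm (tp +ᵖ (0ℚ ∷ qp)) (s -ᵖ tp) ⟩
    (s -ᵖ tp) +ᵖ (tp +ᵖ (0ℚ ∷ qp))   ≈⟨ +ᵖ-assoc (s -ᵖ tp) tp (0ℚ ∷ qp) ⟨
    (s -ᵖ tp +ᵖ tp) +ᵖ (0ℚ ∷ qp)     ≈⟨ +ᵖ-congʳ (0ℚ ∷ qp) (//-rightDividesˡ tp s) ⟩
    s +ᵖ (0ℚ ∷ qp)                   ≈⟨ ∷-cong (ℚ.+-identityʳ a) (≈-trans (+ᵖ-comm (f rem p) qp) (≈-sym (division f p))) ⟩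
    a ∷ f                            ∎)
    where
    s = a ∷ f rem p
    tp = (coeff s (deg p) * recip (leading p)) ·ᵖ p
    qp = (f quot p) *ᵖ p

  rem-below : ∀ f {p} → p ≉ 0ᵖ → DegreeBelow (f rem p) (deg p)
  rem-below []      p≉0 = degreeBelow λ _ _ → refl
  rem-below (a ∷ f) {p} p≉0 = degreeBelow λ i n≤i →
    trans (coeff-+ᵖ s (-ᵖ (t ·ᵖ p)) i)
      (trans (cong (coeff s i +_) (trans (coeff--ᵖ (t ·ᵖ p) i) (cong -_ (coeff-·ᵖ t p i)))) (go i n≤i))
    where
    s = a ∷ f rem p
    c = coeff s (deg p)
    t = c * recip (leading p)
    go : ∀ i → deg p ≤ i → coeff s i - t * coeff p i ≡ 0ℚ
    go i n≤i with deg p ℕ.≟ i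
    -- At index `deg p` the factor `recip (leading p)` in t cancels the leading coefficient, leaving
    -- c - c. Above it, both coefficients already vanish.
    ... | yes refl = trans
      (cong (λ x → c - x) (trans (ℚ.*-assoc c (recip (leading p)) (leading p))
        (trans (cong (c *_) (recip-inverseˡ (leading≢0 p p≉0))) (ℚ.*-identityʳ c))))
      (ℚ.+-inverseʳ c)
    go zero    n≤i | no n≢i = contradiction (ℕ.n≤0⇒n≡0 n≤i) n≢i
    go (suc i) n≤i | no n≢i =
      trans (cong₂ (λ x y → x - t * y) (vanish (rem-below f p≉0) i (ℕ.s≤s⁻¹ n<i)) (vanish (deg-below p) (suc i) n<i))
        (trans (ℚ.+-identityˡ _) (cong -_ (ℚ.*-zeroʳ t)))
      where
      n<i = ℕ.≤∧≢⇒< n≤i n≢i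

  ∣-minus-rem : ∀ f p → p ∣ f -ᵖ (f rem p)
  ∣-minus-rem f p = f quot p , x≈z//y ((f quot p) *ᵖ p) (f rem p) f (≈-sym (division f p))

  -- The remainder is a difference of multiples of p and has degree below that of p, so it is zero.
  ∣⇒quot-*ᵖ : ∀ {f p} → p ≉ 0ᵖ → p ∣ f → (f quot p) *ᵖ p ≈ f
  ∣⇒quot-*ᵖ {f} {p} p≉0 p∣f = ≈-sym (≈-trans (division f p)
    (≈-trans (+ᵖ-congˡ ((f quot p) *ᵖ p) r≈0) (+ᵖ-identityʳ _)))
    where
    r = f rem p
    p∣r : p ∣ r
    p∣r = ∣ʳ-respʳ-≈
      (≈-sym (x≈z//y r ((f quot p) *ᵖ p) f (≈-trans (+ᵖ-comm r _) (≈-sym (division f p)))))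
      (∣-minus p∣f (f quot p , ≈-refl))
    r≈0 : r ≈ 0ᵖ
    r≈0 = ∣-below⇒≈0 (deg-hasDegree p≉0) p∣r (rem-below f p≉0)

-- Cyclotomic polynomials: exactness, comaximality and degree.

module Cyclotomic where
  open Polynomial
  open Degree
  open TotientSum using (divisorSum; ∑-φ)
  open import Data.Bool using (if_then_else_)
  open import Data.Integer as ℤ using ()
  import Data.Integer.Properties as ℤ
  open import Data.List using ([]; _∷_)
  open import Data.Nat as ℕ using (ℕ; zero; suc; s≤s; _≤_; _<_; NonZero)
  open import Data.Nat.Divisibility as ℕ using (_∣?_)
  open import Data.Nat.GCD using (gcd; gcd[m,n]∣m; gcd[m,n]∣n; gcd[m,n]≢0)
  open import Data.Nat.Induction using (<-rec)
  import Data.Nat.Properties as ℕ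
  open import Data.Product using (_,_; ∃₂)
  open import Data.Rational as ℚ using (ℚ; 0ℚ; 1ℚ; _+_; -_; _/_)
  open import Data.Rational.Unnormalised as ℚᵘ using (mkℚᵘ; *≡*)
  import Data.Rational.Unnormalised.Properties as ℚᵘ
  open import Data.Rational.Properties as ℚ using ()
  open import Data.Sum using (inj₁)
  open import Function using (_∘_)
  open import Relation.Binary.Definitions using (tri<; tri≈; tri>)
  open import Relation.Binary.PropositionalEquality
  open import Relation.Nullary using (yes; no; contradiction)
  open import Relation.Nullary.Decidable using (isYes≗does; dec-true)

  open Comaximality polyRing
  open CommutativeRing polyRing using (semiring; distribˡ)
  open import Algebra.Properties.Semiring.Exp semiring using (_^_)
  open import Algebra.Properties.Semiring.Divisibility semiring using (x∣y∧y≉0⇒x≉0)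
  open import Algebra.Properties.Ring (CommutativeRing.ring polyRing) using (-‿distribʳ-*; +-inverseʳ-unique)
  open import Relation.Binary.Reasoning.Setoid polySetoid

  X-*ᵖ : ∀ p → X *ᵖ p ≈ 0ℚ ∷ p
  X-*ᵖ p = ≈-trans (0∷-*ᵖ 1ᵖ p) (∷-cong refl (*ᵖ-identityˡ p))

  X^≈ : ∀ n → X^ n ≈ X ^ n
  X^≈ zero    = ≈-refl
  X^≈ (suc n) = ≈-trans (∷-cong refl (X^≈ n)) (≈-sym (X-*ᵖ (X ^ n)))

  1-X^ : ℕ → Poly
  1-X^ n = 1ᵖ -ᵖ X^ n

  1-X^≈ : ∀ n → 1-X^ n ≈ 1ᵖ -ᵖ X ^ n
  1-X^≈ n = +ᵖ-congˡ 1ᵖ (-ᵖ-cong (X^≈ n))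

  1-X^-∣ : ∀ {m n} → m ℕ.∣ n → 1-X^ m ∣ 1-X^ n
  1-X^-∣ {m} {n} m∣n with q , e ← 1-x^-∣ X m∣n =
    q , ≈-trans (*ᵖ-congˡ q (1-X^≈ m)) (≈-trans e (≈-sym (1-X^≈ n)))

  1-X^-gcd : ∀ m n → ∃₂ λ α β → α *ᵖ 1-X^ m +ᵖ β *ᵖ 1-X^ n ≈ 1-X^ (gcd m n)
  1-X^-gcd m n with α , β , e ← 1-x^gcd X m n =
    α , β , ≈-trans (+ᵖ-cong (*ᵖ-congˡ α (1-X^≈ m)) (*ᵖ-congˡ β (1-X^≈ n)))
      (≈-trans e (≈-sym (1-X^≈ (gcd m n))))

  1-X^-hasDegree : ∀ n .{{_ : NonZero n}} → HasDegree (1-X^ n) n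
  1-X^-hasDegree (suc n) = hasDegree
    (degreeBelow λ { (suc i) (s≤s n<i) → trans (coeff--ᵖ (X^ n) i) (cong -_ (above n n<i)) })
    λ e → 1≢0 (trans (sym (cong -_ (at n))) (trans (sym (coeff--ᵖ (X^ n) n)) e))
    where
    at : ∀ n → coeff (X^ n) n ≡ 1ℚ
    at zero    = refl
    at (suc n) = at n
    above : ∀ n {i} → n < i → coeff (X^ n) i ≡ 0ℚ
    above zero    (s≤s _)   = refl
    above (suc n) (s≤s n<i) = above n n<i
    1≢0 : - 1ℚ ≢ 0ℚ
    1≢0 ()

  fromℕ : ℕ → ℚ
  fromℕ n = ℤ.+ n / 1

  -- `_/_` normalises by a gcd, which does not reduce for a variable n; the equation is therefore
  -- checked among unnormalised fractions.
  fromℕ-suc : ∀ n → fromℕ (suc n) ≡ 1ℚ + fromℕ n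
  fromℕ-suc n = ℚ.toℚᵘ-injective (ℚᵘ.≃-trans (ℚ.toℚᵘ-fromℚᵘ (mkℚᵘ (ℤ.+ suc n) 0))
    (ℚᵘ.≃-sym (ℚᵘ.≃-trans (ℚ.toℚᵘ-homo-+ 1ℚ (fromℕ n))
      (ℚᵘ.≃-trans (ℚᵘ.+-congʳ ℚᵘ.1ℚᵘ (ℚ.toℚᵘ-fromℚᵘ (mkℚᵘ (ℤ.+ n) 0)))
        (*≡* (cong (λ i → (ℤ.+ 1 ℤ.+ i) ℤ.* ℤ.+ 1) (ℤ.*-identityʳ (ℤ.+ n))))))))

  fromℕ≢0 : ∀ n .{{_ : NonZero n}} → fromℕ n ≢ 0ℚ
  fromℕ≢0 n e = ℕ.≢-nonZero⁻¹ n
    (trans (sym (ℕ.*-identityʳ n)) (ℚ.normalize-injective-≃ n 0 1 1 e))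

  const-inverseˡ : ∀ {c} → c ≢ 0ℚ → const (recip c) *ᵖ const c ≈ 1ᵖ
  const-inverseˡ {c} c≢0 = ∷-cong (trans (ℚ.+-identityʳ _) (recip-inverseˡ c≢0)) ≈-refl

  -- Unlike the plain derivative, θ has the monomials as eigenvectors, with eigenvalue n at Xⁿ; no
  -- exponent n - 1 appears.
  θ : Poly → Poly
  θ p = X *ᵖ derivative p

  θ-cong : ∀ {p q} → p ≈ q → θ p ≈ θ q
  θ-cong e = *ᵖ-congˡ X (derivative-cong e)

  θ-*ᵖ : ∀ p q → θ (p *ᵖ q) ≈ θ p *ᵖ q +ᵖ p *ᵖ θ q
  θ-*ᵖ p q = begin
    X *ᵖ derivative (p *ᵖ q)                          ≈⟨ *ᵖ-congˡ X (derivative-*ᵖ p q) ⟩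
    X *ᵖ (derivative p *ᵖ q +ᵖ p *ᵖ derivative q)     ≈⟨ distribˡ X (derivative p *ᵖ q) (p *ᵖ derivative q) ⟩
    X *ᵖ (derivative p *ᵖ q) +ᵖ X *ᵖ (p *ᵖ derivative q)
      ≈⟨ +ᵖ-cong (*ᵖ-assoc X (derivative p) q) (x∙yz≈y∙xz p X (derivative q)) ⟨
    θ p *ᵖ q +ᵖ p *ᵖ θ q                              ∎
    where
    open import Algebra.Properties.CommutativeSemigroup
      (CommutativeRing.*-commutativeSemigroup polyRing) using (x∙yz≈y∙xz)

  θ-X^ : ∀ n → θ (X^ n) ≈ const (fromℕ n) *ᵖ X^ n
  θ-X^ zero    = ≈-trans (*ᵖ-congˡ X {derivative 1ᵖ} (0∷-≈0 refl ≈-refl))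
    (≈-trans (*ᵖ-zeroʳ X) (≈-sym (0∷-≈0 refl ≈-refl)))
  θ-X^ (suc n) = begin
    X *ᵖ (X^ n +ᵖ (0ℚ ∷ derivative (X^ n)))       ≈⟨ X-*ᵖ _ ⟩
    0ℚ ∷ (X^ n +ᵖ (0ℚ ∷ derivative (X^ n)))       ≈⟨ ∷-cong refl (+ᵖ-congˡ (X^ n) (≈-trans (≈-sym (X-*ᵖ _)) (θ-X^ n))) ⟩
    0ℚ ∷ (X^ n +ᵖ const (fromℕ n) *ᵖ X^ n)        ≈⟨ ∷-cong refl (+ᵖ-cong (≈-sym (1·ᵖ (X^ n))) (const-*ᵖ (fromℕ n) (X^ n))) ⟩
    0ℚ ∷ (1ℚ ·ᵖ X^ n +ᵖ fromℕ n ·ᵖ X^ n)          ≈⟨ ∷-cong refl (·ᵖ-distribʳ 1ℚ (fromℕ n) (X^ n)) ⟨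
    0ℚ ∷ (1ℚ + fromℕ n) ·ᵖ X^ n                   ≈⟨ ∷-cong (sym (ℚ.*-zeroʳ (fromℕ (suc n)))) (·ᵖ-cong (sym (fromℕ-suc n)) (≈-refl {X^ n})) ⟩
    fromℕ (suc n) ·ᵖ X^ suc n                     ≈⟨ const-*ᵖ (fromℕ (suc n)) (X^ suc n) ⟨
    const (fromℕ (suc n)) *ᵖ X^ suc n             ∎

  θ-1-X^ : ∀ n → const (fromℕ n) +ᵖ θ (1-X^ n) ≈ const (fromℕ n) *ᵖ 1-X^ n
  θ-1-X^ n = begin
    c +ᵖ X *ᵖ derivative (1ᵖ -ᵖ X^ n)
      ≈⟨ +ᵖ-congˡ c (*ᵖ-congˡ X (≈-trans (derivative-+ᵖ 1ᵖ (-ᵖ X^ n)) (+ᵖ-congʳ (derivative (-ᵖ X^ n)) (0∷-≈0 refl ≈-refl)))) ⟩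
    c +ᵖ X *ᵖ derivative (-ᵖ X^ n)
      ≈⟨ +ᵖ-congˡ c (*ᵖ-congˡ X (derivative--ᵖ (X^ n))) ⟩
    c +ᵖ X *ᵖ -ᵖ derivative (X^ n)
      ≈⟨ +ᵖ-congˡ c (-‿distribʳ-* X (derivative (X^ n))) ⟨
    c -ᵖ θ (X^ n)
      ≈⟨ +ᵖ-congˡ c (-ᵖ-cong (θ-X^ n)) ⟩
    c -ᵖ c *ᵖ X^ n
      ≈⟨ +ᵖ-cong (≈-trans (*ᵖ-comm c 1ᵖ) (*ᵖ-identityˡ c)) (≈-sym (-‿distribʳ-* c (X^ n))) ⟨
    c *ᵖ 1ᵖ +ᵖ c *ᵖ -ᵖ X^ n
      ≈⟨ distribˡ c 1ᵖ (-ᵖ X^ n) ⟨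
    c *ᵖ 1-X^ n ∎
    where
    c = const (fromℕ n)
    derivative--ᵖ : ∀ p → derivative (-ᵖ p) ≈ -ᵖ derivative p
    derivative--ᵖ p = +-inverseʳ-unique (derivative p) _
      (≈-trans (≈-sym (derivative-+ᵖ p (-ᵖ p))) (derivative-cong (-ᵖ-inverseʳ p)))

  1-X^-squarefree : ∀ n .{{_ : NonZero n}} {p q} → p *ᵖ q ≈ 1-X^ n → Comaximal p q
  1-X^-squarefree n {p} {q} e = comaximal-factors {u′ = θ p} {v′ = θ q} {n⁻¹ = const (recip (fromℕ n))} e
    (≈-trans (θ-cong (≈-sym e)) (θ-*ᵖ p q))
    (const-inverseˡ (fromℕ≢0 n)) (θ-1-X^ n)

  Φ-∣-∏Φ∣ : ∀ {n e} b → e < b → suc e ℕ.∣ n → Φ (suc e) ∣ ∏Φ∣ n b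
  Φ-∣-∏Φ∣ {n} {e} (suc b) e<b e∣n with suc b ∣? n | e ℕ.≟ b
  ... | yes _  | yes refl = ∏Φ∣ n b , *ᵖ-comm (∏Φ∣ n b) (Φ (suc b))
  ... | yes _  | no e≢b   = x∣ʳy⇒x∣ʳzy (Φ (suc b)) (Φ-∣-∏Φ∣ b (ℕ.≤∧≢⇒< (ℕ.s≤s⁻¹ e<b) e≢b) e∣n)
  ... | no b∤n | yes refl = contradiction e∣n b∤n
  ... | no _   | no e≢b   = Φ-∣-∏Φ∣ b (ℕ.≤∧≢⇒< (ℕ.s≤s⁻¹ e<b) e≢b) e∣n

  comaximal-∏Φ∣ : ∀ {p n} b → (∀ {e} → e < b → suc e ℕ.∣ n → Comaximal p (Φ (suc e))) →
    Comaximal p (∏Φ∣ n b)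
  comaximal-∏Φ∣ zero c = comaximal-1
  comaximal-∏Φ∣ {p} {n} (suc b) c with suc b ∣? n
  ... | yes b∣n = comaximal-* (c (ℕ.n<1+n b) b∣n) (comaximal-∏Φ∣ b (λ e<b → c (ℕ.m<n⇒m<1+n e<b)))
  ... | no _    = comaximal-∏Φ∣ b (λ e<b → c (ℕ.m<n⇒m<1+n e<b))

  -- The division defining `Φ (suc n)` leaves no remainder. The shift of the index keeps the junk
  -- value `Φ 0` out of the induction.
  Exact : ℕ → Set
  Exact n = Φ (suc n) *ᵖ ∏Φ∣ (suc n) n ≈ 1-X^ (suc n)

  exact⇒Φ-∣ : ∀ n → Exact n → Φ (suc n) ∣ 1-X^ (suc n)
  exact⇒Φ-∣ n e = ∏Φ∣ (suc n) n , ≈-trans (*ᵖ-comm (∏Φ∣ (suc n) n) (Φ (suc n))) e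

  exact⇒∏Φ∣ : ∀ n → Exact n → ∏Φ∣ (suc n) (suc n) ≈ 1-X^ (suc n)
  exact⇒∏Φ∣ n e with suc n ∣? suc n
  ... | yes _ = e
  ... | no ∤  = contradiction ℕ.∣-refl ∤

  -- Φ b is comaximal with Φ e for the proper divisors e of b, since 1 - Xᵇ is
  -- squarefree, hence with 1 - Xᵍ for g = gcd(a, b) < b.  The latter is a
  -- combination of 1 - Xᵃ and 1 - Xᵇ.
  exact⇒comaximal : ∀ {a b} → a < b → (∀ {c} → c ≤ b → Exact c) → Comaximal (Φ (suc a)) (Φ (suc b))
  exact⇒comaximal {a} {b} a<b exact =
    go (gcd (suc a) (suc b)) (gcd[m,n]≢0 (suc a) (suc b) (inj₁ λ ()))
      (gcd[m,n]∣m (suc a) (suc b)) (gcd[m,n]∣n (suc a) (suc b)) (1-X^-gcd (suc a) (suc b))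
    where
    squarefree : Comaximal (Φ (suc b)) (∏Φ∣ (suc b) b)
    squarefree = 1-X^-squarefree (suc b) (exact ℕ.≤-refl)
    go : ∀ g → g ≢ 0 → g ℕ.∣ suc a → g ℕ.∣ suc b →
      (∃₂ λ α β → α *ᵖ 1-X^ (suc a) +ᵖ β *ᵖ 1-X^ (suc b) ≈ 1-X^ g) →
      Comaximal (Φ (suc a)) (Φ (suc b))
    go zero    g≢0 g∣a g∣b _           = contradiction refl g≢0
    go (suc g) _   g∣a g∣b (α , β , e) = comaximal-∣-combination α β
      (exact⇒Φ-∣ a (exact (ℕ.<⇒≤ a<b))) (exact⇒Φ-∣ b (exact ℕ.≤-refl))
      (comaximal-≈ (≈-trans (exact⇒∏Φ∣ g (exact (ℕ.<⇒≤ g<b))) (≈-sym e))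
        (comaximal-∏Φ∣ (suc g) (λ c≤g c∣g →
          comaximal-∣ (Φ-∣-∏Φ∣ b (ℕ.<-≤-trans c≤g g<b) (ℕ.∣-trans c∣g g∣b)) squarefree)))
      where
      g<b : g < b
      g<b = ℕ.≤-<-trans (ℕ.s≤s⁻¹ (ℕ.∣⇒≤ g∣a)) a<b

  -- Each new factor `Φ (suc b)` is comaximal with the product of the earlier ones, and both divide
  -- 1 - Xⁿ. Exactness is assumed only at the indices occurring in the product, which is what the
  -- strong induction can supply.
  ∏Φ∣-∣ : ∀ {n} b → (∀ {c} → c < b → Exact c) → ∏Φ∣ n b ∣ 1-X^ n
  ∏Φ∣-∣ {n} zero    exact = 1-X^ n , ≈-trans (*ᵖ-comm (1-X^ n) 1ᵖ) (*ᵖ-identityˡ (1-X^ n))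
  ∏Φ∣-∣ {n} (suc b) exact with suc b ∣? n
  ... | no _    = ∏Φ∣-∣ b (exact ∘ ℕ.m<n⇒m<1+n)
  ... | yes b∣n = comaximal-*-∣
    (comaximal-∏Φ∣ b (λ e<b _ → comaximal-sym (exact⇒comaximal e<b (exact ∘ s≤s))))
    (∣ʳ-trans (exact⇒Φ-∣ b (exact (ℕ.n<1+n b))) (1-X^-∣ b∣n))
    (∏Φ∣-∣ b (exact ∘ ℕ.m<n⇒m<1+n))

  1-X^-≉0 : ∀ n .{{_ : NonZero n}} → 1-X^ n ≉ 0ᵖ
  1-X^-≉0 n = hasDegree-≉0 (1-X^-hasDegree n)

  -- The divisor in the recursion for `Φ (suc n)` involves only smaller indices, so the induction
  -- hypothesis makes it divide 1 - Xⁿ⁺¹. As a divisor of a nonzero polynomial it is nonzero, and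
  -- the quotient is exact.
  Φ-exact : ∀ n → Exact n
  Φ-exact = <-rec Exact λ n exact →
    ∣⇒quot-*ᵖ (x∣y∧y≉0⇒x≉0 (∏Φ∣-∣ n exact) (1-X^-≉0 (suc n))) (∏Φ∣-∣ n exact)

  Φ-∣ : ∀ n .{{_ : NonZero n}} → Φ n ∣ 1-X^ n
  Φ-∣ (suc n) = exact⇒Φ-∣ n (Φ-exact n)

  Φ-comaximal : ∀ m n .{{_ : NonZero m}} .{{_ : NonZero n}} → m ≢ n → Comaximal (Φ m) (Φ n)
  Φ-comaximal (suc m) (suc n) m≢n with ℕ.<-cmp m n
  ... | tri< m<n _ _ = exact⇒comaximal m<n (λ {c} _ → Φ-exact c)
  ... | tri≈ _ m≡n _ = contradiction (cong suc m≡n) m≢n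
  ... | tri> _ _ n<m = comaximal-sym (exact⇒comaximal n<m (λ {c} _ → Φ-exact c))

  ∏Φ∣-hasDegree : ∀ {n} b → (∀ {e} → e < b → HasDegree (Φ (suc e)) (φ (suc e))) →
    HasDegree (∏Φ∣ n b) (divisorSum n b φ)
  ∏Φ∣-hasDegree zero    h = hasDegree (degreeBelow λ { (suc i) _ → refl }) λ ()
  ∏Φ∣-hasDegree {n} (suc b) h with suc b ∣? n
  ... | yes _ = hasDegree-*ᵖ (h (ℕ.n<1+n b)) (∏Φ∣-hasDegree b (h ∘ ℕ.m<n⇒m<1+n))
  ... | no _  = ∏Φ∣-hasDegree b (h ∘ ℕ.m<n⇒m<1+n)

  -- Compare degrees in Φ(n+1) ∏ Φ(e) = 1 - Xⁿ⁺¹, with e over the proper divisors. By induction the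
  -- product has degree D, the sum of their totients, and `∑-φ` says that φ(n+1) + D = n + 1; cancel
  -- D.
  Φ-hasDegree : ∀ n .{{_ : NonZero n}} → HasDegree (Φ n) (φ n)
  Φ-hasDegree (suc n) = <-rec (λ n → HasDegree (Φ (suc n)) (φ (suc n))) step n
    where
    step : ∀ n → (∀ {e} → e < n → HasDegree (Φ (suc e)) (φ (suc e))) → HasDegree (Φ (suc n)) (φ (suc n))
    step n h = subst (HasDegree (Φ (suc n))) (ℕ.+-cancelʳ-≡ D (deg (Φ (suc n))) (φ (suc n)) (trans
        (hasDegree-unique (hasDegree-≈ (Φ-exact n) (hasDegree-*ᵖ degΦ (∏Φ∣-hasDegree n h)))
          (1-X^-hasDegree (suc n)))
        (trans (sym (∑-φ (suc n)))
          -- The top term of the divisor sum is guarded by the test whether n + 1 divides itself;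
          -- evaluating it to true splits off φ(n+1).
          (cong (λ d → (if d then φ (suc n) else 0) ℕ.+ D) (trans (isYes≗does (suc n ∣? suc n)) (dec-true (suc n ∣? suc n) ℕ.∣-refl))))))
      degΦ
      where
      D = divisorSum (suc n) n φ
      degΦ : HasDegree (Φ (suc n)) (deg (Φ (suc n)))
      degΦ = deg-hasDegree (x∣y∧y≉0⇒x≉0 (Φ-∣ (suc n)) (1-X^-≉0 (suc n)))

-- The partial fraction decomposition.

open Polynomial
open Degree
open Cyclotomic
open import Data.Integer using (+_)
open import Data.Fin using (zero; suc)
open import Data.Nat as ℕ using (zero; suc; ≢-nonZero; ≢-nonZero⁻¹)
import Data.Nat.Properties as ℕ
open import Data.Nat.Divisibility as ℕ using ()
open import Data.Nat.LCM using (m∣lcm[m,n]; n∣lcm[m,n]; lcm-least)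
open import Data.Product using (_,_; _×_; proj₁; proj₂)
open import Data.Rational using (0ℚ)
open import Data.Vec.Functional using (Vector; tail; removeAt)
open import Relation.Binary.PropositionalEquality using (_≢_; refl; sym; trans; cong; cong₂; subst)
open import Relation.Nullary using (yes; no; contradiction)
open Comaximality polyRing
open HasDegree
open CommutativeRing polyRing using (*-commutativeMonoid; *-commutativeSemigroup; +-abelianGroup)
open import Algebra.Properties.AbelianGroup +-abelianGroup using (x∙y⁻¹≈ε⇒x≈y)
open import Algebra.Properties.CommutativeSemigroup *-commutativeSemigroup using (x∙yz≈y∙xz)
open import Algebra.Properties.CommutativeMonoid.Sum *-commutativeMonoid
  using () renaming (sum-remove to ∏ᵖ-remove; sum-cong-≋ to ∏ᵖ-cong)
open import Relation.Binary.Reasoning.Setoid polySetoid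

∣-lcms : ∀ {k} (d : Vector ℕ k) j → d j ℕ.∣ lcms d
∣-lcms d zero    = m∣lcm[m,n] (d zero) (lcms (tail d))
∣-lcms d (suc j) = ℕ.∣-trans (∣-lcms (tail d) j) (n∣lcm[m,n] (d zero) (lcms (tail d)))

-- The lcm divides the product, which is nonzero by induction, whereas 0 divides only 0.
lcms-nonZero : ∀ {k} (d : Vector ℕ k) → (∀ j → NonZero (d j)) → NonZero (lcms d)
lcms-nonZero {zero}  d d≢0 = _
lcms-nonZero {suc k} d d≢0 = ≢-nonZero λ lcm≡0 → ≢-nonZero⁻¹ (d zero ℕ.* lcms (tail d))
  (ℕ.0∣⇒≡0 (subst (ℕ._∣ d zero ℕ.* lcms (tail d)) lcm≡0
    (lcm-least {d zero} {lcms (tail d)} (ℕ.m∣m*n (lcms (tail d))) (ℕ.n∣m*n (d zero)))))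
  where instance
    _ = ℕ.m*n≢0 (d zero) (lcms (tail d)) {{d≢0 zero}} {{lcms-nonZero (tail d) (d≢0 ∘ suc)}}

·ᵖ-≉0 : ∀ {c p} → c ≢ 0ℚ → p ≉ 0ᵖ → c ·ᵖ p ≉ 0ᵖ
·ᵖ-≉0 {c} {p} c≢0 p≉0 e = p≉0 (mk≈ λ n → *-cancel-0 c≢0 (trans (sym (coeff-·ᵖ c p n)) (coeff-≡ e n)))

∏ᵖ-hasDegree : ∀ {k} (D : Vector Poly k) (δ : Vector ℕ k) →
  (∀ j → HasDegree (D j) (δ j)) → HasDegree (∏ᵖ D) (sum δ)
∏ᵖ-hasDegree {zero}  D δ h = hasDegree (degreeBelow λ { (suc i) _ → refl }) λ ()
∏ᵖ-hasDegree {suc k} D δ h = hasDegree-*ᵖ (h zero) (∏ᵖ-hasDegree (tail D) (tail δ) (h ∘ suc))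

-- In the j-th summand `r j`, of degree less than `δ j`, stands in for the missing factor `D j`.
numerator-below : ∀ {k} (r D : Vector Poly k) (δ : Vector ℕ k) →
  (∀ j → HasDegree (D j) (δ j)) → (∀ j → DegreeBelow (r j) (δ j)) →
  DegreeBelow (numerator r D) (sum δ)
numerator-below {zero}  r D δ h b = degreeBelow λ _ _ → refl
numerator-below {suc k} r D δ h b = below-+ᵖ _ _
  (below-*ᵖ (r zero) _ (b zero) (below (∏ᵖ-hasDegree (tail D) (tail δ) (h ∘ suc))))
  (subst (DegreeBelow _) (ℕ.+-comm (sum (tail δ)) (δ zero))
    (below-*ᵖ (numerator (tail r) (tail D)) (D zero)
      (numerator-below (tail r) (tail D) (tail δ) (h ∘ suc) (b ∘ suc)) (below (h zero))))

-- The field `den≉0` is irrelevant, so the proof found by `≈0?` and the given one yield the same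
-- fraction by `refl`.
/ᶠ-≉0 : ∀ p {q} (q≉0 : q ≉ 0ᵖ) → p /ᶠ q ≡ mkFrac p q q≉0
/ᶠ-≉0 p {q} q≉0 with q ≈0?
... | yes q≈0 = contradiction q≈0 q≉0
... | no _    = refl

-- `numerator` unfolds exactly as the iterated `_+ᶠ_` does, without cancelling common factors; hence
-- `≡` and not merely `≈`.
Σᶠ-/ᶠ : ∀ {k} (r D : Vector Poly k) → (∀ j → D j ≉ 0ᵖ) →
  num (Σᶠ (λ j → r j /ᶠ D j)) ≡ numerator r D × den (Σᶠ (λ j → r j /ᶠ D j)) ≡ ∏ᵖ D
Σᶠ-/ᶠ {zero}  r D D≉0 = refl , refl
Σᶠ-/ᶠ {suc k} r D D≉0
  rewrite /ᶠ-≉0 (r zero) (D≉0 zero)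
  with n , d ← Σᶠ-/ᶠ (tail r) (tail D) (D≉0 ∘ suc)
  = cong₂ (λ x y → r zero *ᵖ y +ᵖ x *ᵖ D zero) n d , cong (D zero *ᵖ_) d

∏ᶠ-1/ᶠ : ∀ {k} (D : Vector Poly k) → (∀ j → D j ≉ 0ᵖ) →
  num (∏ᶠ (λ j → 1ᵖ /ᶠ D j)) ≈ 1ᵖ × den (∏ᶠ (λ j → 1ᵖ /ᶠ D j)) ≡ ∏ᵖ D
∏ᶠ-1/ᶠ {zero}  D D≉0 = ≈-refl , refl
∏ᶠ-1/ᶠ {suc k} D D≉0
  rewrite /ᶠ-≉0 1ᵖ (D≉0 zero)
  with n , d ← ∏ᶠ-1/ᶠ (tail D) (D≉0 ∘ suc)
  = ≈-trans (*ᵖ-identityˡ _) n , cong (D zero *ᵖ_) d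

module _ {k} (d : Vector ℕ k) (d≢0 : ∀ j → NonZero (d j)) (d-injective : Injective _≡_ _≡_ d) where

  private
    instance
      dⱼ≢0 : ∀ {j} → NonZero (d j)
      dⱼ≢0 {j} = d≢0 j
    m = lcms d
    Φᵈ : Vector Poly k
    Φᵈ = Φ ∘ d

  Φᵈ-hasDegree : ∀ j → HasDegree (Φᵈ j) (φ (d j))
  Φᵈ-hasDegree j = Φ-hasDegree (d j)

  ∏Φᵈ-hasDegree : HasDegree (∏ᵖ Φᵈ) (sum (φ ∘ d))
  ∏Φᵈ-hasDegree = ∏ᵖ-hasDegree Φᵈ (φ ∘ d) Φᵈ-hasDegree

  -- Distinctness of the `d j` enters here: it makes the factors pairwise comaximal.
  ∏Φᵈ-∣ : ∀ {p} → (∀ j → Φᵈ j ∣ p) → ∏ᵖ Φᵈ ∣ p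
  ∏Φᵈ-∣ = ∏-∣ Φᵈ (λ {i} {j} i≢j → Φ-comaximal (d i) (d j) (i≢j ∘ d-injective))

  -- Each Φ dⱼ divides 1 - X^dⱼ, which divides 1 - Xᵐ because dⱼ divides m.
  quot-∏Φᵈ : (1-X^ m quot ∏ᵖ Φᵈ) *ᵖ ∏ᵖ Φᵈ ≈ 1-X^ m
  quot-∏Φᵈ = ∣⇒quot-*ᵖ (hasDegree-≉0 ∏Φᵈ-hasDegree)
    (∏Φᵈ-∣ (λ j → ∣ʳ-trans (Φ-∣ (d j)) (1-X^-∣ (∣-lcms d j))))

-- Φⱼ (g P) = 1 - Xᵐ and θ(1 - Xᵐ) = m (1 - Xᵐ) - m give (θ Φⱼ) g P ≡ -m modulo Φⱼ.
Φ-∣-residue : ∀ {k m} (d : Vector ℕ (suc k)) f g → g *ᵖ ∏ᵖ (Φ ∘ d) ≈ 1-X^ m → ∀ j →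
  Φ (d j) ∣ const (fromℕ m) *ᵖ f
    -ᵖ ((-ᵖ (f *ᵖ g *ᵖ X *ᵖ derivative (Φ (d j)))) rem Φ (d j)) *ᵖ ∏ᵖ (removeAt (Φ ∘ d) j)
Φ-∣-residue {m = m} d f g e j = ∣-residue {g = g} {P = P} {f = f} {c = c}
    (c *ᵖ (g *ᵖ P) -ᵖ θ (g *ᵖ P) , factor-derivative {u = p} {v = g *ᵖ P} {u′ = θ p} {n = c} pgP≈1-X^m
      (≈-trans (θ-cong (≈-sym pgP≈1-X^m)) (θ-*ᵖ p (g *ᵖ P))) (θ-1-X^ m))
    (∣-minus-rem (-ᵖ (f *ᵖ g *ᵖ X *ᵖ derivative p)) p)
  where
  c = const (fromℕ m)
  p = Φ (d j)
  P = ∏ᵖ (removeAt (Φ ∘ d) j)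
  pgP≈1-X^m : p *ᵖ (g *ᵖ P) ≈ 1-X^ m
  pgP≈1-X^m = ≈-trans (x∙yz≈y∙xz p g P) (≈-trans (*ᵖ-congˡ g (≈-sym (∏ᵖ-remove {i = j} (Φ ∘ d)))) e)

partialFractions : ∀ {k} (d : Vector ℕ k) → (∀ j → NonZero (d j)) → Injective _≡_ _≡_ d →
  ∀ f → deg f < sum (φ ∘ d) →
  let m = lcms d
      g = 1-X^ m quot ∏ᵖ (Φ ∘ d)
      r = λ j → (-ᵖ (f *ᵖ g *ᵖ X *ᵖ derivative (Φ (d j)))) rem Φ (d j)
  in const (fromℕ m) *ᵖ f ≈ numerator r (Φ ∘ d)
-- For k = 0 the degree hypothesis reads `deg f < 0` and is absurd, so only `suc k`, the form that
-- `removeAt` needs, remains.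
partialFractions {suc k} d d≢0 d-inj f f<φ = x∙y⁻¹≈ε⇒x≈y (c *ᵖ f) N
  (∣-below⇒≈0 (∏Φᵈ-hasDegree d d≢0 d-inj)
    (∏Φᵈ-∣ d d≢0 d-inj (λ j → ∣-minus-common {x = c *ᵖ f} {y = N} {z = r j *ᵖ ∏ᵖ (removeAt (Φ ∘ d) j)}
      (Φ-∣-residue {m = m} d f g (quot-∏Φᵈ d d≢0 d-inj) j) (numerator-mod r (Φ ∘ d) j)))
    (below-+ᵖ (c *ᵖ f) (-ᵖ N)
      -- The constant c has degree below 1, so c f has degree below `1 ℕ.+ deg f`; `f<φ` unfolds to
      -- the statement that this is at most the sum of the totients.
      (below-mono f<φ (below-*ᵖ c f {1} {deg f} (degreeBelow λ { (suc i) _ → refl }) (deg-below f)))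
      (below--ᵖ N (numerator-below r (Φ ∘ d) (φ ∘ d) Φᵈ-deg r-below))))
  where
  m = lcms d
  c = const (fromℕ m)
  g = 1-X^ m quot ∏ᵖ (Φ ∘ d)
  r : Vector Poly (suc k)
  r j = (-ᵖ (f *ᵖ g *ᵖ X *ᵖ derivative (Φ (d j)))) rem Φ (d j)
  N = numerator r (Φ ∘ d)
  Φᵈ-deg = Φᵈ-hasDegree d d≢0 d-inj
  r-below : ∀ j → DegreeBelow (r j) (φ (d j))
  r-below j = subst (DegreeBelow (r j))
    (hasDegree-unique (deg-hasDegree (hasDegree-≉0 (Φᵈ-deg j))) (Φᵈ-deg j))
    (rem-below (-ᵖ (f *ᵖ g *ᵖ X *ᵖ derivative (Φ (d j)))) (hasDegree-≉0 (Φᵈ-deg j)))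

theorem4p1 : (k : ℕ) (d : Vector ℕ k) →
    (∀ j → NonZero (d j)) →
    Injective _≡_ _≡_ d →
    (f : Poly) →
    deg f < sum (φ ∘ d) →
    let m = lcms d in
    (∀ z → IsRoot f z → ¬ IsRootOfUnity m z) →
    let g = (1ᵖ -ᵖ X^ m) quot ∏ᵖ (Φ ∘ d) in
    fromPoly f *ᶠ ∏ᶠ (λ j → 1ᵖ /ᶠ Φ (d j))
    ≃ Σᶠ (λ j → ((-ᵖ (f *ᵖ g *ᵖ X *ᵖ derivative (Φ (d j)))) rem Φ (d j))
    /ᶠ ((+ m / 1) ·ᵖ Φ (d j)))
theorem4p1 k d d≢0 d-inj f f<φ _ = mk≃ (begin
  f *ᵖ num ∏ *ᵖ den Σ
    ≈⟨ *ᵖ-cong (≈-trans (*ᵖ-congˡ f num-∏) (≈-trans (*ᵖ-comm f 1ᵖ) (*ᵖ-identityˡ f))) (≈-reflexive den-Σ) ⟩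
  f *ᵖ ∏ᵖ (λ j → fromℕ m ·ᵖ Φᵈ j)
    -- `numerator-unscale` lives in a ring, so scaling by the rational m is turned into
    -- multiplication by the constant polynomial c, and back again afterwards.
    ≈⟨ *ᵖ-congˡ f (∏ᵖ-cong (λ j → const-*ᵖ (fromℕ m) (Φᵈ j))) ⟨
  f *ᵖ ∏ᵖ (λ j → c *ᵖ Φᵈ j)
    ≈⟨ numerator-unscale {c⁻¹ = const (recip (fromℕ m))} r Φᵈ (const-inverseˡ m≢0) (partialFractions d d≢0 d-inj f f<φ) ⟩
  numerator r (λ j → c *ᵖ Φᵈ j) *ᵖ ∏ᵖ Φᵈ
    -- The factor `1ᵖ` in front of `den ∏` is the denominator of `fromPoly f`.
    ≈⟨ *ᵖ-cong (≈-trans (≈-reflexive num-Σ) (≈-sym (numerator-cong r (λ j → const-*ᵖ (fromℕ m) (Φᵈ j)))))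
         (≈-trans (*ᵖ-identityˡ (den ∏)) (≈-reflexive den-∏)) ⟨
  num Σ *ᵖ (1ᵖ *ᵖ den ∏) ∎)
  where
  m = lcms d
  c = const (fromℕ m)
  Φᵈ : Vector Poly k
  Φᵈ = Φ ∘ d
  g = 1-X^ m quot ∏ᵖ Φᵈ
  r : Vector Poly k
  r j = (-ᵖ (f *ᵖ g *ᵖ X *ᵖ derivative (Φᵈ j))) rem Φᵈ j
  ∏ = ∏ᶠ (λ j → 1ᵖ /ᶠ Φᵈ j)
  Σ = Σᶠ (λ j → r j /ᶠ (fromℕ m ·ᵖ Φᵈ j))
  m≢0 = fromℕ≢0 m {{lcms-nonZero d d≢0}}
  Φᵈ≉0 : ∀ j → Φᵈ j ≉ 0ᵖ
  Φᵈ≉0 j = hasDegree-≉0 (Φᵈ-hasDegree d d≢0 d-inj j)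
  mΦᵈ≉0 : ∀ j → fromℕ m ·ᵖ Φᵈ j ≉ 0ᵖ
  mΦᵈ≉0 j = ·ᵖ-≉0 m≢0 (Φᵈ≉0 j)
  num-∏ = proj₁ (∏ᶠ-1/ᶠ Φᵈ Φᵈ≉0)
  den-∏ = proj₂ (∏ᶠ-1/ᶠ Φᵈ Φᵈ≉0)
  num-Σ = proj₁ (Σᶠ-/ᶠ r (λ j → fromℕ m ·ᵖ Φᵈ j) mΦᵈ≉0)
  den-Σ = proj₂ (Σᶠ-/ᶠ r (λ j → fromℕ m ·ᵖ Φᵈ j) mΦᵈ≉0)
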